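{- Fix an integer $n\ge 2$, and assume that for every choice of positive integers $w_1,\ldots,w_n$ one has either $\mathrm{ML}(w_1,\ldots,w_n)=\frac{s}{ns+1}$ for some $s\in\mathbb{N}$ or $\mathrm{ML}(w_1,\ldots,w_n)\ge\frac1n$. Then for any positive real numbers $v_1,\ldots,v_n$, either $\mathrm{ML}(v_1,\ldots,v_n)=\frac{s}{ns+1}$ for some $s\in\mathbb{N}$, or $\mathrm{ML}(v_1,\ldots,v_n)\ge\frac1n$.
   Context: For a real number $x$, $\Vert x\Vert$ denotes the distance from $x$ to the nearest integer. For positive real numbers $v_1,\ldots,v_k$, the maximum loneliness is $\mathrm{ML}(v_1,\ldots,v_k)=\sup_{t\in\mathbb{R}}\min_{1\le i\le k}\Vert t v_i\Vert$ (for integer speeds the supremum is a maximum). Here $\mathbb{N}=\{1,2,3,\ldots\}$. -}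

module Defs where

open import Axiom.ExcludedMiddle using (ExcludedMiddle)
open import Data.Empty using (⊥; ⊥-elim)
open import Data.Fin using (Fin; zero; suc)
open import Data.Integer as ℤ using (ℤ; +_; -[1+_])
import Data.Integer.DivMod as ℤ
import Data.Integer.Properties as ℤ
open import Data.Nat as ℕ using (ℕ; zero; suc; s≤s; z≤n)
import Data.Nat.Properties as ℕ
open import Data.Nat.Coprimality as C using (1-coprimeTo)
open import Data.Product using (Σ; ∃; ∃-syntax; _×_; _,_; proj₁; proj₂)
open import Data.Rational as ℚ using (ℚ; mkℚ; 0ℚ; 1ℚ; ½; *<*; *≤*)
import Data.Rational.Properties as ℚ
open import Data.Rational.Solver using (module +-*-Solver)
open import Data.Sum using (_⊎_; inj₁; inj₂; [_,_]′)
open import Function using (_∘_)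
open import Level using (0ℓ)
open import Relation.Binary.PropositionalEquality using (_≡_; refl; sym; trans; cong; cong₂; subst; subst₂)
open import Relation.Nullary using (¬_; Dec; yes; no)
open import Relation.Nullary.Decidable using (decidable-stable)
open +-*-Solver using (solve; _:=_; _:+_; _:*_; :-_; _:-_; con)

-- Linear inequalities are proved by certificates: to derive c < d, give
-- some a < b together with the identity b - a ≡ d - c.

opaque
  shift : ∀ a c → (c ℚ.- a) ℚ.+ a ≡ c
  shift = solve 2 (λ a c → (c :- a) :+ a := c) refl

opaque
  shift′ : ∀ a b c d → b ℚ.- a ≡ d ℚ.- c → (c ℚ.- a) ℚ.+ b ≡ d
  shift′ a b c d e = trans
    (solve 3 (λ a b c → (c :- a) :+ b := (b :- a) :+ c) refl a b c)
    (trans (cong (ℚ._+ c) e) (shift c d))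

opaque
  by-< : ∀ {a b c d} → a ℚ.< b → b ℚ.- a ≡ d ℚ.- c → c ℚ.< d
  by-< {a} {b} {c} {d} a<b e =
    subst₂ ℚ._<_ (shift a c) (shift′ a b c d e) (ℚ.+-monoʳ-< (c ℚ.- a) a<b)

opaque
  by-≤ : ∀ {a b c d} → a ℚ.≤ b → b ℚ.- a ≡ d ℚ.- c → c ℚ.≤ d
  by-≤ {a} {b} {c} {d} a≤b e =
    subst₂ ℚ._≤_ (shift a c) (shift′ a b c d e) (ℚ.+-monoʳ-≤ (c ℚ.- a) a≤b)

opaque
  0<1 : 0ℚ ℚ.< 1ℚ
  0<1 = ℚ.positive⁻¹ 1ℚ

opaque
  half : ∀ ε → 0ℚ ℚ.< ε → ∃[ η ] (0ℚ ℚ.< η × η ℚ.+ η ≡ ε)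
  half ε 0<ε = ½ ℚ.* ε
    , subst (ℚ._< ½ ℚ.* ε) (ℚ.*-zeroʳ ½) (ℚ.*-monoʳ-<-pos ½ 0<ε)
    , solve 1 (λ e → con ½ :* e :+ con ½ :* e := e) refl ε

opaque
  p≤∣p∣ : ∀ p → p ℚ.≤ ℚ.∣ p ∣
  p≤∣p∣ p with ℚ.≤-total 0ℚ p
  ... | inj₁ 0≤p = ℚ.≤-reflexive (sym (ℚ.0≤p⇒∣p∣≡p 0≤p))
  ... | inj₂ p≤0 = ℚ.≤-trans p≤0 (ℚ.0≤∣p∣ p)

opaque
  -p≤∣p∣ : ∀ p → ℚ.- p ℚ.≤ ℚ.∣ p ∣
  -p≤∣p∣ p = subst (ℚ.- p ℚ.≤_) (ℚ.∣-p∣≡∣p∣ p) (p≤∣p∣ (ℚ.- p))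

opaque
  ∣p∣<e : ∀ {p e} → p ℚ.< e → ℚ.- p ℚ.< e → ℚ.∣ p ∣ ℚ.< e
  ∣p∣<e {p} p<e -p<e with ℚ.∣p∣≡p∨∣p∣≡-p p
  ... | inj₁ eq = subst (ℚ._< _) (sym eq) p<e
  ... | inj₂ eq = subst (ℚ._< _) (sym eq) -p<e

opaque
  ∣-∣-sym : ∀ p q → ℚ.∣ p ℚ.- q ∣ ≡ ℚ.∣ q ℚ.- p ∣
  ∣-∣-sym p q = trans (sym (ℚ.∣-p∣≡∣p∣ (p ℚ.- q)))
    (cong ℚ.∣_∣ (solve 2 (λ p q → :- (p :- q) := q :- p) refl p q))

opaque
  ∣p-q∣<e⇒p<q+e : ∀ {p q e} → ℚ.∣ p ℚ.- q ∣ ℚ.< e → p ℚ.< q ℚ.+ e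
  ∣p-q∣<e⇒p<q+e {p} {q} {e} h = by-< (ℚ.≤-<-trans (p≤∣p∣ (p ℚ.- q)) h)
    (solve 3 (λ p q e → e :- (p :- q) := (q :+ e) :- p) refl p q e)

opaque
  ∣p-q∣<e⇒q<p+e : ∀ {p q e} → ℚ.∣ p ℚ.- q ∣ ℚ.< e → q ℚ.< p ℚ.+ e
  ∣p-q∣<e⇒q<p+e {p} {q} h = ∣p-q∣<e⇒p<q+e (subst (ℚ._< _) (∣-∣-sym p q) h)

opaque
  <⇒∣p-q∣<e : ∀ {p q e} → p ℚ.< q ℚ.+ e → q ℚ.< p ℚ.+ e → ℚ.∣ p ℚ.- q ∣ ℚ.< e
  <⇒∣p-q∣<e {p} {q} {e} h k = ∣p∣<e
    (by-< h (solve 3 (λ p q e → (q :+ e) :- p := e :- (p :- q)) refl p q e))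
    (by-< k (solve 3 (λ p q e → (p :+ e) :- q := e :- (:- (p :- q))) refl p q e))

opaque
  ∣p∣≤∣p-q∣+∣q∣ : ∀ p q → ℚ.∣ p ∣ ℚ.≤ ℚ.∣ p ℚ.- q ∣ ℚ.+ ℚ.∣ q ∣
  ∣p∣≤∣p-q∣+∣q∣ p q = subst (λ r → ℚ.∣ r ∣ ℚ.≤ ℚ.∣ p ℚ.- q ∣ ℚ.+ ℚ.∣ q ∣) (shift q p)
    (ℚ.∣p+q∣≤∣p∣+∣q∣ (p ℚ.- q) q)

δ : ℕ → ℚ
δ n = mkℚ (+ 1) n (1-coprimeTo (suc n))

opaque
  0<δ : ∀ n → 0ℚ ℚ.< δ n
  0<δ n = ℚ.positive⁻¹ (δ n)

opaque
  δ-small : ∀ ε → 0ℚ ℚ.< ε → ∃[ N ] (∀ n → N ℕ.≤ n → δ n ℚ.< ε)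
  δ-small (mkℚ (+ zero) d _) (*<* (ℤ.+<+ ()))
  δ-small (mkℚ -[1+ _ ] d _) (*<* ())
  δ-small (mkℚ (+ suc a) d _) _ = suc d , λ n d<n → *<* (ℤ.+<+ (s≤s
    (subst (λ z → suc z ℕ.≤ n ℕ.+ a ℕ.* suc n) (sym (ℕ.+-identityʳ d))
      (ℕ.≤-trans d<n (ℕ.m≤m+n n _)))))

-- The normalised form of k / 1.
ι : ℤ → ℚ
ι k = mkℚ k 0 (C.sym (1-coprimeTo ℤ.∣ k ∣))

opaque
  /1≡ι : ∀ k → k ℚ./ 1 ≡ ι k
  /1≡ι k = ℚ.↥p/↧p≡p (ι k)

opaque
  ι-+ : ∀ i j → ι (i ℤ.+ j) ≡ ι i ℚ.+ ι j
  ι-+ i j = trans (sym (/1≡ι (i ℤ.+ j)))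
    (cong (ℚ._/ 1) (sym (cong₂ ℤ._+_ (ℤ.*-identityʳ i) (ℤ.*-identityʳ j))))

opaque
  ι-mono : ∀ {i j} → i ℤ.≤ j → ι i ℚ.≤ ι j
  ι-mono i≤j = *≤* (ℤ.*-monoʳ-≤-nonNeg (+ 1) i≤j)

opaque
  ∣∣-bound : ∀ q → ∃[ M ] (ℚ.∣ q ∣ ℚ.≤ ι (+ M))
  ∣∣-bound (mkℚ n d _) = ℤ.∣ n ∣ ,
    *≤* (ℤ.*-monoˡ-≤-nonNeg (+ ℤ.∣ n ∣) (ℤ.+≤+ (s≤s z≤n)))

opaque
  floor-bound : ∀ q → ∃[ k ] (ι k ℚ.≤ q × q ℚ.≤ ι k ℚ.+ 1ℚ)
  floor-bound q@(mkℚ n d _) = n ℤ./ℕ suc d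
    , *≤* (subst (n ℤ./ℕ suc d ℤ.* + suc d ℤ.≤_) (sym (ℤ.*-identityʳ n)) (ℤ.[n/ℕd]*d≤n n (suc d)))
    , subst (q ℚ.≤_) (trans (ι-+ (+ 1) (n ℤ./ℕ suc d)) (ℚ.+-comm 1ℚ (ι (n ℤ./ℕ suc d))))
        (*≤* (subst (ℤ._≤ ℤ.suc (n ℤ./ℕ suc d) ℤ.* + suc d) (sym (ℤ.*-identityʳ n))
          (ℤ.<⇒≤ (ℤ.n<s[n/ℕd]*d n (suc d)))))

times : ℕ → ℚ → ℚ
times zero    d = 0ℚ
times (suc J) d = d ℚ.+ times J d

opaque
  times≡ : ∀ J d → times J d ≡ ι (+ J) ℚ.* d
  times≡ zero    d = sym (ℚ.*-zeroˡ d)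
  times≡ (suc J) d = trans (cong (d ℚ.+_) (times≡ J d))
    (trans (solve 2 (λ d j → d :+ j :* d := (con 1ℚ :+ j) :* d) refl d (ι (+ J)))
      (cong (ℚ._* d) (sym (ι-+ (+ 1) (+ J)))))

opaque
  archimedean : ∀ a d → 0ℚ ℚ.< d → ∃[ J ] (a ℚ.≤ times J d)
  archimedean a d 0<d = J , subst₂ ℚ._≤_ cancel (sym (times≡ J d)) (ℚ.*-monoʳ-≤-nonNeg d b≤J)
    where
    instance
      d-pos : ℚ.Positive d
      d-pos = ℚ.positive 0<d
      d-nonNeg : ℚ.NonNegative d
      d-nonNeg = ℚ.pos⇒nonNeg d
      d≢0 : ℚ.NonZero d
      d≢0 = ℚ.pos⇒nonZero d
    b : ℚ
    b = a ℚ.* (ℚ.1/ d)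
    J : ℕ
    J = proj₁ (∣∣-bound b)
    b≤J : b ℚ.≤ ι (+ J)
    b≤J = ℚ.≤-trans (p≤∣p∣ b) (proj₂ (∣∣-bound b))
    cancel : b ℚ.* d ≡ a
    cancel = trans (ℚ.*-assoc a _ d) (trans (cong (a ℚ.*_) (ℚ.*-inverseˡ d)) (ℚ.*-identityʳ a))

Eventually : (ℕ → Set) → Set
Eventually P = ∃[ N ] (∀ n → N ℕ.≤ n → P n)

opaque
  _and_ : ∀ {P Q : ℕ → Set} → Eventually P → Eventually Q → Eventually (λ n → P n × Q n)
  (M , p) and (N , q) = M ℕ.⊔ N , λ n le →
    p n (ℕ.≤-trans (ℕ.m≤m⊔n M N) le) , q n (ℕ.≤-trans (ℕ.m≤n⊔m M N) le)

opaque
  always : ∀ {P : ℕ → Set} → (∀ n → P n) → Eventually P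
  always p = 0 , λ n _ → p n

opaque
  weaken : ∀ {P Q : ℕ → Set} → (∀ n → P n → Q n) → Eventually P → Eventually Q
  weaken f (N , p) = N , λ n le → f n (p n le)

IsCauchy : (ℕ → ℚ) → Set
IsCauchy x = ∀ ε → 0ℚ ℚ.< ε →
  ∃[ N ] (∀ m n → N ℕ.≤ m → N ℕ.≤ n → ℚ.∣ x m ℚ.- x n ∣ ℚ.< ε)

-- ℝ is a setoid: equality of reals is _≈ℝ_, which identifies sequences whose
-- difference tends to zero.
record ℝ : Set where
  constructor mkℝ
  field
    seq    : ℕ → ℚ
    cauchy : IsCauchy seq

open ℝ public

infix 4 _≈ℝ_ _≤ℝ_ _<ℝ_

_≈ℝ_ _≤ℝ_ _<ℝ_ : ℝ → ℝ → Set
x ≈ℝ y = ∀ ε → 0ℚ ℚ.< ε → Eventually (λ n → ℚ.∣ seq x n ℚ.- seq y n ∣ ℚ.< ε)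
x ≤ℝ y = ∀ ε → 0ℚ ℚ.< ε → Eventually (λ n → seq x n ℚ.< seq y n ℚ.+ ε)
x <ℝ y = ∃[ ε ] (0ℚ ℚ.< ε × Eventually (λ n → seq x n ℚ.+ ε ℚ.< seq y n))

OneSided : (ℕ → ℚ) → Set
OneSided x = ∀ ε → 0ℚ ℚ.< ε →
  ∃[ N ] (∀ m n → N ℕ.≤ m → N ℕ.≤ n → x m ℚ.< x n ℚ.+ ε)

opaque
  one-sided : ∀ x → OneSided x → IsCauchy x
  one-sided x h ε 0<ε with h ε 0<ε
  ... | N , p = N , λ m n Nm Nn → <⇒∣p-q∣<e {x m} {x n} {ε} (p m n Nm Nn) (p n m Nn Nm)

opaque
  near : ∀ x → OneSided (seq x)
  near x ε 0<ε with cauchy x ε 0<ε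
  ... | N , p = N , λ m n Nm Nn → ∣p-q∣<e⇒p<q+e {seq x m} {seq x n} {ε} (p m n Nm Nn)

opaque
  near₂ : ∀ x y ε → 0ℚ ℚ.< ε → ∃[ N ] (∀ m n → N ℕ.≤ m → N ℕ.≤ n →
    seq x m ℚ.< seq x n ℚ.+ ε × seq y m ℚ.< seq y n ℚ.+ ε)
  near₂ x y ε 0<ε with near x ε 0<ε | near y ε 0<ε
  ... | M , p | N , q = M ℕ.⊔ N , λ m n Lm Ln →
      p m n (ℕ.m⊔n≤o⇒m≤o M N Lm) (ℕ.m⊔n≤o⇒m≤o M N Ln)
    , q m n (ℕ.m⊔n≤o⇒n≤o M N Lm) (ℕ.m⊔n≤o⇒n≤o M N Ln)

opaque
  p<p+ε : ∀ p {ε} → 0ℚ ℚ.< ε → p ℚ.< p ℚ.+ ε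
  p<p+ε p {ε} 0<ε = by-< 0<ε (solve 2 (λ q e → e :- con 0ℚ := (q :+ e) :- q) refl p ε)

opaque
  const-cauchy : ∀ q → IsCauchy (λ _ → q)
  const-cauchy q = one-sided (λ _ → q) λ ε 0<ε → 0 , λ _ _ _ _ → p<p+ε q 0<ε

fromℚ : ℚ → ℝ
fromℚ q = mkℝ (λ _ → q) (const-cauchy q)

fromℤ : ℤ → ℝ
fromℤ k = fromℚ (k ℚ./ 1)

fromℕ : ℕ → ℝ
fromℕ k = fromℤ (+ k)

0ℝ : ℝ
0ℝ = fromℚ 0ℚ

infixl 6 _+ℝ_ _-ℝ_
infixl 7 _*ℝ_ _⊓ℝ_
infix  8 -ℝ_

opaque
  +-cauchy : ∀ x y → IsCauchy (λ n → seq x n ℚ.+ seq y n)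
  +-cauchy x y = one-sided _ pf
    where
    pf : OneSided (λ n → seq x n ℚ.+ seq y n)
    pf ε 0<ε with half ε 0<ε
    ... | η , 0<η , refl with near₂ x y η 0<η
    ... | N , p = N , λ m n Nm Nn →
      by-< (ℚ.+-mono-< (proj₁ (p m n Nm Nn)) (proj₂ (p m n Nm Nn)))
        (solve 5 (λ a b c d e → ((b :+ e) :+ (d :+ e)) :- (a :+ c) := ((b :+ d) :+ (e :+ e)) :- (a :+ c))
          refl (seq x m) (seq x n) (seq y m) (seq y n) η)

_+ℝ_ : ℝ → ℝ → ℝ
x +ℝ y = mkℝ (λ n → seq x n ℚ.+ seq y n) (+-cauchy x y)

opaque
  neg-cauchy : ∀ x → IsCauchy (λ n → ℚ.- seq x n)
  neg-cauchy x = one-sided _ pf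
    where
    pf : OneSided (λ n → ℚ.- seq x n)
    pf ε 0<ε with near x ε 0<ε
    ... | N , p = N , λ m n Nm Nn → by-< (p n m Nn Nm)
      (solve 3 (λ a b e → (a :+ e) :- b := (:- b :+ e) :- (:- a)) refl (seq x m) (seq x n) ε)

-ℝ_ : ℝ → ℝ
-ℝ x = mkℝ (λ n → ℚ.- seq x n) (neg-cauchy x)

_-ℝ_ : ℝ → ℝ → ℝ
x -ℝ y = x +ℝ (-ℝ y)

opaque
  ∣∣-cauchy : ∀ x → IsCauchy (λ n → ℚ.∣ seq x n ∣)
  ∣∣-cauchy x = one-sided _ pf
    where
    pf : OneSided (λ n → ℚ.∣ seq x n ∣)
    pf ε 0<ε with cauchy x ε 0<ε
    ... | N , p = N , λ m n Nm Nn → ℚ.≤-<-trans (∣p∣≤∣p-q∣+∣q∣ (seq x m) (seq x n))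
      (subst (ℚ.∣ seq x m ℚ.- seq x n ∣ ℚ.+ ℚ.∣ seq x n ∣ ℚ.<_) (ℚ.+-comm ε ℚ.∣ seq x n ∣)
        (ℚ.+-monoˡ-< ℚ.∣ seq x n ∣ (p m n Nm Nn)))

∣_∣ℝ : ℝ → ℝ
∣ x ∣ℝ = mkℝ (λ n → ℚ.∣ seq x n ∣) (∣∣-cauchy x)

opaque
  ⊓-cauchy : ∀ x y → IsCauchy (λ n → seq x n ℚ.⊓ seq y n)
  ⊓-cauchy x y = one-sided _ pf
    where
    go : ∀ ε m n → seq x m ℚ.< seq x n ℚ.+ ε × seq y m ℚ.< seq y n ℚ.+ ε →
         seq x m ℚ.⊓ seq y m ℚ.< (seq x n ℚ.⊓ seq y n) ℚ.+ ε
    go ε m n (a , b) = [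
        (λ e → subst (λ z → seq x m ℚ.⊓ seq y m ℚ.< z ℚ.+ ε) (sym e)
          (ℚ.≤-<-trans (ℚ.p⊓q≤p (seq x m) (seq y m)) a)) ,
        (λ e → subst (λ z → seq x m ℚ.⊓ seq y m ℚ.< z ℚ.+ ε) (sym e)
          (ℚ.≤-<-trans (ℚ.p⊓q≤q (seq x m) (seq y m)) b)) ]′
      (ℚ.⊓-sel (seq x n) (seq y n))
    pf : OneSided (λ n → seq x n ℚ.⊓ seq y n)
    pf ε 0<ε with near₂ x y ε 0<ε
    ... | N , p = N , λ m n Nm Nn → go ε m n (p m n Nm Nn)

_⊓ℝ_ : ℝ → ℝ → ℝ
x ⊓ℝ y = mkℝ (λ n → seq x n ℚ.⊓ seq y n) (⊓-cauchy x y)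

opaque
  bounded : ∀ x → ∃[ B ] (0ℚ ℚ.< B × Eventually (λ n → ℚ.∣ seq x n ∣ ℚ.< B))
  bounded x with cauchy x 1ℚ 0<1
  ... | N , p = 1ℚ ℚ.+ ℚ.∣ seq x N ∣
    , ℚ.<-≤-trans 0<1 (by-≤ (ℚ.0≤∣p∣ (seq x N))
        (solve 1 (λ a → a :- con 0ℚ := (con 1ℚ :+ a) :- con 1ℚ) refl ℚ.∣ seq x N ∣))
    , N , λ n Nn → ℚ.≤-<-trans (∣p∣≤∣p-q∣+∣q∣ (seq x n) (seq x N))
        (ℚ.+-monoˡ-< ℚ.∣ seq x N ∣ (p n N Nn ℕ.≤-refl))

opaque
  divide : ∀ b c ε → 0ℚ ℚ.< b → 0ℚ ℚ.< c → 0ℚ ℚ.< ε →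
    ∃[ η ] (0ℚ ℚ.< η × b ℚ.* η ℚ.+ c ℚ.* η ≡ ε)
  divide b c ε 0<b 0<c 0<ε = ε ℚ.* (ℚ.1/ d)
    , subst (ℚ._< ε ℚ.* (ℚ.1/ d)) (ℚ.*-zeroˡ (ℚ.1/ d)) (ℚ.*-monoˡ-<-pos (ℚ.1/ d) 0<ε)
    , trans (solve 4 (λ b c e i → b :* (e :* i) :+ c :* (e :* i) := e :* (i :* (b :+ c))) refl b c ε (ℚ.1/ d))
        (trans (cong (ε ℚ.*_) (ℚ.*-inverseˡ d)) (ℚ.*-identityʳ ε))
    where
    d : ℚ
    d = b ℚ.+ c
    instance
      d-pos : ℚ.Positive d
      d-pos = ℚ.positive (ℚ.+-mono-< 0<b 0<c)
      d≢0 : ℚ.NonZero d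
      d≢0 = ℚ.pos⇒nonZero d
      d⁻¹-pos : ℚ.Positive (ℚ.1/ d)
      d⁻¹-pos = ℚ.1/pos⇒pos d

opaque
  ∣*∣-bound : ∀ {b η} → 0ℚ ℚ.< b → ∀ p q → ℚ.∣ p ∣ ℚ.< b → ℚ.∣ q ∣ ℚ.< η → ℚ.∣ p ℚ.* q ∣ ℚ.< b ℚ.* η
  ∣*∣-bound {b} {η} 0<b p q p<b q<η = subst (ℚ._< b ℚ.* η) (sym (ℚ.∣p*q∣≡∣p∣*∣q∣ p q))
    (ℚ.≤-<-trans (ℚ.*-monoʳ-≤-nonNeg ℚ.∣ q ∣ {{ℚ.∣-∣-nonNeg q}} (ℚ.<⇒≤ p<b))
      (ℚ.*-monoʳ-<-pos b {{ℚ.positive 0<b}} q<η))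

opaque
  *-cauchy : ∀ x y → IsCauchy (λ n → seq x n ℚ.* seq y n)
  *-cauchy x y ε 0<ε with bounded x | bounded y
  ... | B , 0<B , M₁ , bx | C , 0<C , M₂ , by with divide B C ε 0<B 0<C 0<ε
  ... | η , 0<η , refl with cauchy x η 0<η | cauchy y η 0<η
  ... | M₃ , cx | M₄ , cy = (M₁ ℕ.⊔ M₂) ℕ.⊔ (M₃ ℕ.⊔ M₄) , λ m n Nm Nn →
      subst (λ a → ℚ.∣ a ∣ ℚ.< B ℚ.* η ℚ.+ C ℚ.* η) (split (seq x m) (seq x n) (seq y m) (seq y n))
        (ℚ.≤-<-trans
          (ℚ.∣p+q∣≤∣p∣+∣q∣ (seq x m ℚ.* (seq y m ℚ.- seq y n)) (seq y n ℚ.* (seq x m ℚ.- seq x n)))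
          (ℚ.+-mono-<
            (∣*∣-bound 0<B (seq x m) (seq y m ℚ.- seq y n) (bx m (l₁ Nm)) (cy m n (l₄ Nm) (l₄ Nn)))
            (∣*∣-bound 0<C (seq y n) (seq x m ℚ.- seq x n) (by n (l₂ Nn)) (cx m n (l₃ Nm) (l₃ Nn)))))
    where
    split : ∀ a b c d → a ℚ.* (c ℚ.- d) ℚ.+ d ℚ.* (a ℚ.- b) ≡ a ℚ.* c ℚ.- b ℚ.* d
    split = solve 4 (λ a b c d → a :* (c :- d) :+ d :* (a :- b) := a :* c :- b :* d) refl
    l₁ : ∀ {k} → (M₁ ℕ.⊔ M₂) ℕ.⊔ (M₃ ℕ.⊔ M₄) ℕ.≤ k → M₁ ℕ.≤ k
    l₁ = ℕ.m⊔n≤o⇒m≤o M₁ M₂ ∘ ℕ.m⊔n≤o⇒m≤o (M₁ ℕ.⊔ M₂) (M₃ ℕ.⊔ M₄)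
    l₂ : ∀ {k} → (M₁ ℕ.⊔ M₂) ℕ.⊔ (M₃ ℕ.⊔ M₄) ℕ.≤ k → M₂ ℕ.≤ k
    l₂ = ℕ.m⊔n≤o⇒n≤o M₁ M₂ ∘ ℕ.m⊔n≤o⇒m≤o (M₁ ℕ.⊔ M₂) (M₃ ℕ.⊔ M₄)
    l₃ : ∀ {k} → (M₁ ℕ.⊔ M₂) ℕ.⊔ (M₃ ℕ.⊔ M₄) ℕ.≤ k → M₃ ℕ.≤ k
    l₃ = ℕ.m⊔n≤o⇒m≤o M₃ M₄ ∘ ℕ.m⊔n≤o⇒n≤o (M₁ ℕ.⊔ M₂) (M₃ ℕ.⊔ M₄)
    l₄ : ∀ {k} → (M₁ ℕ.⊔ M₂) ℕ.⊔ (M₃ ℕ.⊔ M₄) ℕ.≤ k → M₄ ℕ.≤ k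
    l₄ = ℕ.m⊔n≤o⇒n≤o M₃ M₄ ∘ ℕ.m⊔n≤o⇒n≤o (M₁ ℕ.⊔ M₂) (M₃ ℕ.⊔ M₄)

_*ℝ_ : ℝ → ℝ → ℝ
x *ℝ y = mkℝ (λ n → seq x n ℚ.* seq y n) (*-cauchy x y)

opaque
  pointwise-≤ : ∀ {x y} → Eventually (λ n → seq x n ℚ.≤ seq y n) → x ≤ℝ y
  pointwise-≤ {y = y} h ε 0<ε = weaken (λ n le → ℚ.≤-<-trans le (p<p+ε (seq y n) 0<ε)) h

opaque
  ≤ℝ-refl : ∀ {x} → x ≤ℝ x
  ≤ℝ-refl {x} = pointwise-≤ {x} {x} (always λ _ → ℚ.≤-refl)

opaque
  ≤ℝ-trans : ∀ {x y z} → x ≤ℝ y → y ≤ℝ z → x ≤ℝ z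
  ≤ℝ-trans {x} {y} {z} x≤y y≤z ε 0<ε with half ε 0<ε
  ... | η , 0<η , refl = weaken
    (λ n (a , b) → by-< (ℚ.+-mono-< a b)
      (solve 4 (λ x y z e → ((y :+ e) :+ (z :+ e)) :- (x :+ y) := (z :+ (e :+ e)) :- x)
        refl (seq x n) (seq y n) (seq z n) η))
    (x≤y η 0<η and y≤z η 0<η)

opaque
  ≈ℝ⇒≤ℝ : ∀ {x y} → x ≈ℝ y → x ≤ℝ y
  ≈ℝ⇒≤ℝ x≈y ε 0<ε = weaken (λ _ → ∣p-q∣<e⇒p<q+e) (x≈y ε 0<ε)

opaque
  <ℝ⇒≤ℝ : ∀ {x y} → x <ℝ y → x ≤ℝ y
  <ℝ⇒≤ℝ {x} {y} (ε , 0<ε , h) = pointwise-≤ {x} {y}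
    (weaken (λ n lt → ℚ.<⇒≤ (ℚ.<-trans (p<p+ε (seq x n) 0<ε) lt)) h)

opaque
  ≮ℝ⇒≥ℝ : ∀ {x y} → ¬ (x <ℝ y) → y ≤ℝ x
  ≮ℝ⇒≥ℝ {x} {y} x≮y ε 0<ε with half ε 0<ε
  ... | η , 0<η , refl with half η 0<η
  ... | κ , 0<κ , refl with near₂ x y κ 0<κ
  ... | N , p = N , λ n Nn → decidable-stable (seq y n ℚ.<? _) λ ¬lt →
    x≮y (κ ℚ.+ κ , 0<η , N , λ m Nm →
      by-< (ℚ.+-mono-<-≤ (ℚ.+-mono-< (proj₁ (p m n Nm Nn)) (proj₂ (p n m Nn Nm))) (ℚ.≮⇒≥ ¬lt))
        (solve 5 (λ xm xn ym yn k →
            (((xn :+ k) :+ (ym :+ k)) :+ yn) :- ((xm :+ yn) :+ (xn :+ ((k :+ k) :+ (k :+ k))))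
              := ym :- (xm :+ (k :+ k)))
          refl (seq x m) (seq x n) (seq y m) (seq y n) κ))

-- Excluded middle stands for the classical logic of ordinary real analysis;
-- constructively the order on ℝ is not total and suprema need not exist.
opaque
  ≤ℝ-total : ExcludedMiddle 0ℓ → ∀ x y → x ≤ℝ y ⊎ y ≤ℝ x
  ≤ℝ-total em x y with em {x <ℝ y}
  ... | yes x<y = inj₁ (<ℝ⇒≤ℝ {x} {y} x<y)
  ... | no  x≮y = inj₂ (≮ℝ⇒≥ℝ {x} {y} x≮y)

UpperBound : (ℝ → Set) → ℝ → Set
UpperBound P b = ∀ x → P x → x ≤ℝ b

IsSupremum : (ℝ → Set) → ℝ → Set
IsSupremum P s = UpperBound P s × (∀ b → UpperBound P b → s ≤ℝ b)

-- The n-th approximant of the supremum is a rational upper bound of P which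
-- ceases to be one when decreased by δ n = 1 / (n + 1).
module Supremum (em : ExcludedMiddle 0ℓ) (P : ℝ → Set)
                (x₀ : ℝ) (Px₀ : P x₀) (b₀ : ℝ) (ub₀ : UpperBound P b₀) where

  U : ℚ → Set
  U q = UpperBound P (fromℚ q)

  opaque
    U-mono : ∀ p q → p ℚ.≤ q → U p → U q
    U-mono p q p≤q Up x Px = ≤ℝ-trans {x} {fromℚ p} {fromℚ q} (Up x Px)
      (pointwise-≤ {fromℚ p} {fromℚ q} (always λ _ → p≤q))

  opaque
    ¬U<U : ∀ p q → ¬ U p → U q → p ℚ.< q
    ¬U<U p q ¬Up Uq = decidable-stable (p ℚ.<? q) λ p≮q → ¬Up (U-mono q p (ℚ.≮⇒≥ p≮q) Uq)

  opaque
    low : ∃[ l ] (¬ U l)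
    low with near x₀ 1ℚ 0<1
    ... | N , p = seq x₀ N ℚ.- (1ℚ ℚ.+ 1ℚ) , λ Ul → absurd (Ul x₀ Px₀ 1ℚ 0<1)
      where
      absurd : Eventually (λ n → seq x₀ n ℚ.< seq x₀ N ℚ.- (1ℚ ℚ.+ 1ℚ) ℚ.+ 1ℚ) → ⊥
      absurd (M , q) = ℚ.<-irrefl {0ℚ} refl
        (by-< (ℚ.+-mono-< (q (N ℕ.⊔ M) (ℕ.m≤n⊔m N M)) (p N (N ℕ.⊔ M) ℕ.≤-refl (ℕ.m≤m⊔n N M)))
          (solve 2 (λ a b → (((a :- (con 1ℚ :+ con 1ℚ)) :+ con 1ℚ) :+ (b :+ con 1ℚ)) :- (b :+ a)
              := con 0ℚ :- con 0ℚ) refl (seq x₀ N) (seq x₀ (N ℕ.⊔ M))))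

  opaque
    high : ∃ U
    high with near b₀ 1ℚ 0<1
    ... | N , p = seq b₀ N ℚ.+ 1ℚ , λ x Px → ≤ℝ-trans {x} {b₀} {fromℚ (seq b₀ N ℚ.+ 1ℚ)} (ub₀ x Px)
      (pointwise-≤ {b₀} {fromℚ (seq b₀ N ℚ.+ 1ℚ)} (N , λ n Nn → ℚ.<⇒≤ (p n N Nn ℕ.≤-refl)))

  opaque
    search : ∀ d J q → ¬ U q → U (q ℚ.+ times J d) → ∃[ p ] (¬ U p × U (p ℚ.+ d))
    search d zero    q ¬Uq Uq′ = ⊥-elim (¬Uq (subst U (ℚ.+-identityʳ q) Uq′))
    search d (suc J) q ¬Uq Uq′ with em {U (q ℚ.+ d)}
    ... | yes Ud = q , ¬Uq , Ud
    ... | no ¬Ud = search d J (q ℚ.+ d) ¬Ud (subst U (sym (ℚ.+-assoc q d (times J d))) Uq′)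

  opaque
    approx : ∀ n → ∃[ p ] (¬ U p × U (p ℚ.+ δ n))
    approx n with low | high
    ... | l , ¬Ul | u , Uu with archimedean (u ℚ.- l) (δ n) (0<δ n)
    ... | J , h = search (δ n) J l ¬Ul (U-mono u (l ℚ.+ times J (δ n))
      (by-≤ h (solve 3 (λ u l t → t :- (u :- l) := (l :+ t) :- u) refl u l (times J (δ n)))) Uu)

  lo hi : ℕ → ℚ
  lo n = proj₁ (approx n)
  hi n = lo n ℚ.+ δ n

  opaque
    hi-close : ∀ m n → hi m ℚ.< hi n ℚ.+ δ m
    hi-close m n = ℚ.+-monoˡ-< (δ m)
      (¬U<U (lo m) (hi n) (proj₁ (proj₂ (approx m))) (proj₂ (proj₂ (approx n))))

  opaque
    hi-cauchy : IsCauchy hi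
    hi-cauchy = one-sided hi λ ε 0<ε → let N , small = δ-small ε 0<ε in
      N , λ m n Nm _ → ℚ.<-trans (hi-close m n) (ℚ.+-monoʳ-< (hi n) (small m Nm))

  s : ℝ
  s = mkℝ hi hi-cauchy

  opaque
    upper : UpperBound P s
    upper x Px ε 0<ε with half ε 0<ε
    ... | η , 0<η , refl with δ-small η 0<η
    ... | N , small = weaken
      (λ n h → by-< (ℚ.+-mono-< h (ℚ.+-mono-< (hi-close N n) (small N ℕ.≤-refl)))
        (solve 5 (λ x hN hn d e → ((hN :+ e) :+ ((hn :+ d) :+ e)) :- (x :+ (hN :+ d)) := (hn :+ (e :+ e)) :- x)
          refl (seq x n) (hi N) (hi n) (δ N) η))
      (proj₂ (proj₂ (approx N)) x Px η 0<η)

  opaque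
    lo≤b : ∀ N b → UpperBound P b → fromℚ (lo N) ≤ℝ b
    lo≤b N b ub = ≮ℝ⇒≥ℝ {b} {fromℚ (lo N)} λ b<lo → proj₁ (proj₂ (approx N)) λ x Px →
      ≤ℝ-trans {x} {b} {fromℚ (lo N)} (ub x Px) (<ℝ⇒≤ℝ {b} {fromℚ (lo N)} b<lo)

  opaque
    least : ∀ b → UpperBound P b → s ≤ℝ b
    least b ub ε 0<ε with half ε 0<ε
    ... | θ , 0<θ , refl with half θ 0<θ
    ... | η , 0<η , refl with δ-small η 0<η
    ... | N , small = weaken
      (λ n (h , dn<η) → by-<
        (ℚ.+-mono-< (ℚ.+-mono-< h (small N ℕ.≤-refl))
          (ℚ.+-mono-< (hi-close n N) (ℚ.+-mono-< dn<η 0<η)))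
        (solve 6 (λ b lN hn dN dn e →
            (((b :+ e) :+ e) :+ (((lN :+ dN) :+ dn) :+ (e :+ e))) :- ((lN :+ dN) :+ (hn :+ (dn :+ con 0ℚ)))
              := (b :+ ((e :+ e) :+ (e :+ e))) :- hn)
          refl (seq b n) (lo N) (hi n) (δ N) (δ n) η))
      (lo≤b N b ub η 0<η and (N , small))

opaque
  supremum : ExcludedMiddle 0ℓ → (P : ℝ → Set) → ∃ P → ∃ (UpperBound P) → Σ ℝ (IsSupremum P)
  supremum em P (x₀ , Px₀) (b₀ , ub₀) = s , upper , least
    where open Supremum em P x₀ Px₀ b₀ ub₀

module Nearest (em : ExcludedMiddle 0ℓ) (x : ℝ) where

  dist : ℤ → ℝ
  dist k = ∣ x -ℝ fromℤ k ∣ℝ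

  infix 4 _≼_

  _≼_ : ℤ → ℤ → Set
  i ≼ j = dist i ≤ℝ dist j

  opaque
    ≼-trans : ∀ i j k → i ≼ j → j ≼ k → i ≼ k
    ≼-trans i j k = ≤ℝ-trans {dist i} {dist j} {dist k}

  opaque
    better : ∀ i j → ∃[ k ] (k ≼ i × k ≼ j)
    better i j with ≤ℝ-total em (dist i) (dist j)
    ... | inj₁ i≼j = i , ≤ℝ-refl {dist i} , i≼j
    ... | inj₂ j≼i = j , j≼i , ≤ℝ-refl {dist j}

  opaque
    argmin : ∀ K → ∃[ k ] (∀ j → ℤ.∣ j ∣ ℕ.≤ K → k ≼ j)
    argmin zero = + 0 , λ { (+ zero) _ → ≤ℝ-refl {dist (+ 0)} ; (+ suc _) () ; -[1+ _ ] () }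
    argmin (suc K) with argmin K
    ... | k , k≼ with better k (+ suc K)
    ... | k₁ , k₁≼k , k₁≼+ with better k₁ -[1+ K ]
    ... | k₂ , k₂≼k₁ , k₂≼- = k₂ , λ j le → go j (ℕ.m≤n⇒m<n∨m≡n le)
      where
      sign : ∀ j → ℤ.∣ j ∣ ≡ suc K → k₂ ≼ j
      sign (+ _) refl = ≼-trans k₂ k₁ (+ suc K) k₂≼k₁ k₁≼+
      sign -[1+ _ ] refl = k₂≼-
      go : ∀ j → ℤ.∣ j ∣ ℕ.< suc K ⊎ ℤ.∣ j ∣ ≡ suc K → k₂ ≼ j
      go j (inj₁ (s≤s le)) = ≼-trans k₂ k₁ j k₂≼k₁ (≼-trans k₁ k j k₁≼k (k≼ j le))
      go j (inj₂ eq) = sign j eq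

  opaque
    far-step : ∀ a m j → ℚ.∣ a ∣ ℚ.≤ m → m ℚ.+ m ℚ.≤ ℚ.∣ j ∣ → ℚ.∣ a ℚ.- 0ℚ ∣ ℚ.≤ ℚ.∣ a ℚ.- j ∣
    far-step a m j h 2m≤j = subst (λ z → ℚ.∣ z ∣ ℚ.≤ ℚ.∣ a ℚ.- j ∣) (sym (ℚ.+-identityʳ a))
      (by-≤ (ℚ.+-mono-≤ (ℚ.+-mono-≤ h h) (ℚ.+-mono-≤ 2m≤j tri))
        (solve 4 (λ X m J D → ((m :+ m) :+ (J :+ (D :+ X))) :- ((X :+ X) :+ ((m :+ m) :+ J)) := D :- X)
          refl ℚ.∣ a ∣ m ℚ.∣ j ∣ ℚ.∣ a ℚ.- j ∣))
      where
      tri : ℚ.∣ j ∣ ℚ.≤ ℚ.∣ a ℚ.- j ∣ ℚ.+ ℚ.∣ a ∣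
      tri = subst (λ z → ℚ.∣ j ∣ ℚ.≤ z ℚ.+ ℚ.∣ a ∣) (∣-∣-sym j a) (∣p∣≤∣p-q∣+∣q∣ j a)

  opaque
    far : ∃[ K ] (∀ j → K ℕ.≤ ℤ.∣ j ∣ → (+ 0) ≼ j)
    far with bounded x
    ... | B , _ , bx with ∣∣-bound B
    ... | M , B≤M = M ℕ.+ M , λ j K≤j → pointwise-≤ {dist (+ 0)} {dist j} (weaken
      (λ n h → subst (λ z → ℚ.∣ seq x n ℚ.- 0ℚ ∣ ℚ.≤ ℚ.∣ seq x n ℚ.- z ∣) (sym (/1≡ι j))
        (far-step (seq x n) (ι (+ M)) (ι j)
          (ℚ.≤-trans (ℚ.<⇒≤ h) (ℚ.≤-trans (p≤∣p∣ B) B≤M))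
          (subst (ℚ._≤ ι (+ ℤ.∣ j ∣)) (ι-+ (+ M) (+ M)) (ι-mono (ℤ.+≤+ K≤j)))))
      bx)

  opaque
    closest : ∃[ k ] (∀ j → k ≼ j)
    closest with far
    ... | K , K-far with argmin K
    ... | k , k≼ = k , λ j → go j (ℤ.∣ j ∣ ℕ.≤? K)
      where
      go : ∀ j → Dec (ℤ.∣ j ∣ ℕ.≤ K) → k ≼ j
      go j (yes le) = k≼ j le
      go j (no ¬le) = ≼-trans k (+ 0) j (k≼ (+ 0) z≤n) (K-far j (ℕ.<⇒≤ (ℕ.≰⇒> ¬le)))

opaque
  nearest : ExcludedMiddle 0ℓ → ∀ x →
    ∃[ k ] (∀ j → ∣ x -ℝ fromℤ k ∣ℝ ≤ℝ ∣ x -ℝ fromℤ j ∣ℝ)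
  nearest em x = Nearest.closest em x

-- k = proj₁ (nearest em x) is an integer with ∣ x - k ∣ minimal; the value
-- ∣ x - k ∣ does not depend on which minimiser is chosen.
∥_∥[_] : ℝ → ExcludedMiddle 0ℓ → ℝ
∥ x ∥[ em ] = ∣ x -ℝ fromℤ (proj₁ (nearest em x)) ∣ℝ

2ℚ : ℚ
2ℚ = 1ℚ ℚ.+ 1ℚ

opaque
  within-2 : ∀ a b c → ℚ.∣ a ℚ.- b ∣ ℚ.< 1ℚ → c ℚ.≤ b → b ℚ.≤ c ℚ.+ 1ℚ → ℚ.∣ a ℚ.- c ∣ ℚ.≤ 2ℚ
  within-2 a b c h lo hi = ℚ.<⇒≤ (<⇒∣p-q∣<e {a} {c} {2ℚ}
    (by-< (ℚ.+-mono-<-≤ (∣p-q∣<e⇒p<q+e {a} {b} {1ℚ} h) hi)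
      (solve 3 (λ a b c → ((b :+ con 1ℚ) :+ (c :+ con 1ℚ)) :- (a :+ b) := (c :+ con 2ℚ) :- a) refl a b c))
    (by-< (ℚ.+-mono-<-≤ (ℚ.+-mono-< (∣p-q∣<e⇒q<p+e {a} {b} {1ℚ} h) 0<1) lo)
      (solve 3 (λ a b c → (((a :+ con 1ℚ) :+ con 1ℚ) :+ b) :- ((b :+ con 0ℚ) :+ c) := (a :+ con 2ℚ) :- c) refl a b c)))

opaque
  ∥∥≤2 : (em : ExcludedMiddle 0ℓ) → ∀ x → ∥ x ∥[ em ] ≤ℝ fromℚ 2ℚ
  ∥∥≤2 em x with cauchy x 1ℚ 0<1
  ... | N , p with floor-bound (seq x N)
  ... | k , lo , hi = ≤ℝ-trans {∥ x ∥[ em ]} {∣ x -ℝ fromℤ k ∣ℝ} {fromℚ 2ℚ}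
    (proj₂ (nearest em x) k)
    (pointwise-≤ {∣ x -ℝ fromℤ k ∣ℝ} {fromℚ 2ℚ} (N , λ n Nn →
      subst (λ z → ℚ.∣ seq x n ℚ.- z ∣ ℚ.≤ 2ℚ) (sym (/1≡ι k))
        (within-2 (seq x n) (seq x N) (ι k) (p n N Nn ℕ.≤-refl) lo hi)))

minimum : ∀ {n} .{{_ : ℕ.NonZero n}} → (Fin n → ℝ) → ℝ
minimum {suc zero}    f = f zero
minimum {suc (suc n)} f = f zero ⊓ℝ minimum (f ∘ suc)

opaque
  minimum-bound : ∀ {n} .{{_ : ℕ.NonZero n}} (f : Fin n → ℝ) b → (∀ i → f i ≤ℝ b) → minimum f ≤ℝ b
  minimum-bound {suc zero}    f b h = h zero
  minimum-bound {suc (suc n)} f b h = ≤ℝ-trans {minimum f} {f zero} {b}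
    (pointwise-≤ {minimum f} {f zero}
      (always λ k → ℚ.p⊓q≤p (seq (f zero) k) (seq (minimum (f ∘ suc)) k)))
    (h zero)

loneliness : ExcludedMiddle 0ℓ → ∀ {n} .{{_ : ℕ.NonZero n}} → (Fin n → ℝ) → ℝ → ℝ
loneliness em v t = minimum (λ i → ∥ t *ℝ v i ∥[ em ])

LonelinessValue : ExcludedMiddle 0ℓ → ∀ {n} .{{_ : ℕ.NonZero n}} → (Fin n → ℝ) → ℝ → Set
LonelinessValue em v y = ∃[ t ] (y ≈ℝ loneliness em v t)

ML-supremum : (em : ExcludedMiddle 0ℓ) → ∀ {n} .{{_ : ℕ.NonZero n}} (v : Fin n → ℝ) →
  Σ ℝ (IsSupremum (LonelinessValue em v))
ML-supremum em v = supremum em (LonelinessValue em v)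
  (loneliness em v 0ℝ , 0ℝ , λ ε 0<ε → always λ n →
    subst (λ z → ℚ.∣ z ∣ ℚ.< ε) (sym (ℚ.+-inverseʳ (seq (loneliness em v 0ℝ) n))) 0<ε)
  (fromℚ 2ℚ , λ y (t , y≈) → ≤ℝ-trans {y} {loneliness em v t} {fromℚ 2ℚ}
    (≈ℝ⇒≤ℝ {y} {loneliness em v t} y≈)
    (minimum-bound (λ i → ∥ t *ℝ v i ∥[ em ]) (fromℚ 2ℚ) (λ i → ∥∥≤2 em (t *ℝ v i))))

-- sup over t : ℝ of min over i of ∥ t v i ∥.
ML : ExcludedMiddle 0ℓ → ∀ {n} .{{_ : ℕ.NonZero n}} → (Fin n → ℝ) → ℝ
ML em v = proj₁ (ML-supremum em v)

{-# OPTIONS --safe #-}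

-- By Dirichlet's theorem there are N ≥ 1 and integers wᵢ with all ∣ N vᵢ - wᵢ ∣
-- as small as desired; they are positive once the error is below min vᵢ. As
-- t w is 1-periodic modulo 1, each of its points is close to a point of the
-- orbit of v, so ML(w) ≤ ML(v) + e; rescaling a nearly optimal time for v by
-- 1 / N gives ML(v) ≤ ML(w) + e. Hence ML(v) is a limit of values ML(w), and
-- { s / (n s + 1) } ∪ [1 / n , ∞) is closed.
module Submission where

open import Defs
open import Axiom.ExcludedMiddle using (ExcludedMiddle)
open import Data.Fin using (Fin)
open import Data.Integer using (+_)
open import Data.Nat using (ℕ; suc; _*_; _≤_; _<_; NonZero)
open import Data.Product using (_×_; ∃-syntax)
open import Data.Rational using (_/_)
open import Data.Sum using (_⊎_)
open import Level using (0ℓ)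

open import Data.Empty using (⊥-elim)
import Data.Fin as Fin
import Data.Fin.Properties as Fin
import Data.Integer as ℤ
import Data.Integer.DivMod as ℤ
import Data.Integer.Properties as ℤ
import Data.Nat as ℕ
import Data.Nat.Properties as ℕ
import Data.Nat.Solver
open import Data.Product using (Σ; _,_; proj₁; proj₂)
open import Data.Rational as ℚ using (ℚ; 0ℚ; 1ℚ)
import Data.Rational.Properties as ℚ
open import Data.Rational.Solver using (module +-*-Solver)
import Data.Rational.Unnormalised as ℚᵘ
import Data.Rational.Unnormalised.Properties as ℚᵘ
open import Data.Sum using (inj₁; inj₂)
open import Function using (_∘_)
open import Relation.Binary.PropositionalEquality using (_≡_; refl; sym; trans; cong; cong₂; subst; subst₂)
open import Relation.Nullary using (¬_; yes; no)
module ℕ-Solver = Data.Nat.Solver.+-*-Solver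
open +-*-Solver using (solve; _:=_; _:+_; _:*_; :-_; _:-_; con)

-- Arithmetic of embedded integers and of minima in the rationals.

ι-* : ∀ i j → ι (i ℤ.* j) ≡ ι i ℚ.* ι j
ι-* i j = sym (/1≡ι (i ℤ.* j))

ι-neg : ∀ i → ι (ℤ.- i) ≡ ℚ.- ι i
ι-neg (+ 0)       = refl
ι-neg (+ suc _)   = refl
ι-neg ℤ.-[1+ _ ]  = refl

ι-- : ∀ i j → ι (i ℤ.- j) ≡ ι i ℚ.- ι j
ι-- i j = trans (ι-+ i (ℤ.- j)) (cong (ι i ℚ.+_) (ι-neg j))

ι-mono-< : ∀ {i j} → i ℤ.< j → ι i ℚ.< ι j
ι-mono-< i<j = ℚ.*<* (ℤ.*-monoʳ-<-pos (+ 1) i<j)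

ι-pos⁻¹ : ∀ i → 0ℚ ℚ.< ι i → ∃[ k ] (0 < k × i ≡ + k)
ι-pos⁻¹ (+ 0)      (ℚ.*<* (ℤ.+<+ ()))
ι-pos⁻¹ (+ suc k)  _ = suc k , ℕ.z<s , refl
ι-pos⁻¹ ℤ.-[1+ _ ] (ℚ.*<* ())

δ-inverse : ∀ N → δ N ℚ.* ι (+ suc N) ≡ 1ℚ
δ-inverse N = ℚ.*-inverseˡ (ι (+ suc N))

∣p∣≤e : ∀ {p e} → p ℚ.≤ e → ℚ.- p ℚ.≤ e → ℚ.∣ p ∣ ℚ.≤ e
∣p∣≤e {p} p≤e -p≤e with ℚ.∣p∣≡p∨∣p∣≡-p p
... | inj₁ eq = subst (ℚ._≤ _) (sym eq) p≤e
... | inj₂ eq = subst (ℚ._≤ _) (sym eq) -p≤e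

positive-min : ∀ {p q} → 0ℚ ℚ.< p → 0ℚ ℚ.< q → 0ℚ ℚ.< p ℚ.⊓ q
positive-min {p} {q} 0<p 0<q with ℚ.⊓-sel p q
... | inj₁ eq = subst (0ℚ ℚ.<_) (sym eq) 0<p
... | inj₂ eq = subst (0ℚ ℚ.<_) (sym eq) 0<q

-- Simultaneous Dirichlet approximation of rational vectors.

opaque
  scale-down : ∀ M ε → 0ℚ ℚ.< ε → ∃[ η ] (0ℚ ℚ.< η × ι (+ suc M) ℚ.* η ℚ.≤ ε)
  scale-down M ε 0<ε with divide (ι (+ suc M)) 1ℚ ε (ℚ.positive⁻¹ _) 0<1 0<ε
  ... | η , 0<η , refl = η , 0<η , by-≤ (ℚ.<⇒≤ 0<η)
    (solve 2 (λ m e → e :- con 0ℚ := (m :* e :+ con 1ℚ :* e) :- m :* e) refl (ι (+ suc M)) η)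

-- The left ends of the two unit intervals have the same remainder `R` modulo `m`, so subtracting
-- the points cancels `R`, with an error of at most 1.
box-error : ∀ m I D Q R A B →
  R ℚ.+ A ℚ.* m ℚ.≤ m ℚ.* (I ℚ.* Q) →
  m ℚ.* (I ℚ.* Q) ℚ.≤ R ℚ.+ A ℚ.* m ℚ.+ 1ℚ →
  R ℚ.+ B ℚ.* m ℚ.≤ m ℚ.* ((I ℚ.+ D) ℚ.* Q) →
  m ℚ.* ((I ℚ.+ D) ℚ.* Q) ℚ.≤ R ℚ.+ B ℚ.* m ℚ.+ 1ℚ →
  ℚ.∣ m ℚ.* (D ℚ.* Q ℚ.- (B ℚ.- A)) ∣ ℚ.≤ 1ℚ
box-error m I D Q R A B lo hi lo′ hi′ = ∣p∣≤e
  (by-≤ (ℚ.+-mono-≤ lo hi′) (solve 7 (λ I D Q R A B m →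
    (m :* (I :* Q) :+ (R :+ B :* m :+ con 1ℚ)) :- ((R :+ A :* m) :+ m :* ((I :+ D) :* Q))
      := con 1ℚ :- m :* (D :* Q :- (B :- A))) refl I D Q R A B m))
  (by-≤ (ℚ.+-mono-≤ hi lo′) (solve 7 (λ I D Q R A B m →
    ((R :+ A :* m :+ con 1ℚ) :+ m :* ((I :+ D) :* Q)) :- (m :* (I :* Q) :+ (R :+ B :* m))
      := con 1ℚ :- (:- (m :* (D :* Q :- (B :- A))))) refl I D Q R A B m))

-- Two of the numbers ⌊ M (j q) ⌋, 0 ≤ j ≤ M, agree modulo M; the corresponding
-- multiples j q then differ from each other by an integer up to 1 / M.
module Pigeonhole (N : ℕ) (q : ℚ) where

  M : ℕ
  M = suc N

  m : ℚ
  m = ι (+ M)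

  point : Fin (suc M) → ℚ
  point j = m ℚ.* (ι (+ Fin.toℕ j) ℚ.* q)

  f : Fin (suc M) → ℤ.ℤ
  f j = proj₁ (floor-bound (point j))

  box : Fin (suc M) → Fin M
  box j = Fin.fromℕ< (ℤ.n%ℕd<d (f j) M)

  ι-f : ∀ j → ι (f j) ≡ ι (+ (f j ℤ.%ℕ M)) ℚ.+ ι (f j ℤ./ℕ M) ℚ.* m
  ι-f j = trans (cong ι (ℤ.a≡a%ℕn+[a/ℕn]*n (f j) M))
    (trans (ι-+ (+ (f j ℤ.%ℕ M)) (f j ℤ./ℕ M ℤ.* + M))
      (cong (ι (+ (f j ℤ.%ℕ M)) ℚ.+_) (ι-* (f j ℤ./ℕ M) (+ M))))

  same-residue : ∀ i j → box i ≡ box j → f i ℤ.%ℕ M ≡ f j ℤ.%ℕ M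
  same-residue i j eq = trans (sym (Fin.toℕ-fromℕ< _)) (trans (cong Fin.toℕ eq) (Fin.toℕ-fromℕ< _))

  unscale : ∀ x → ℚ.∣ m ℚ.* x ∣ ℚ.≤ 1ℚ → ℚ.∣ x ∣ ℚ.≤ δ N
  unscale x h = subst₂ ℚ._≤_
    (trans (cong (δ N ℚ.*_) (ℚ.∣p*q∣≡∣p∣*∣q∣ m x))
      (trans (sym (ℚ.*-assoc (δ N) m ℚ.∣ x ∣))
        (trans (cong (ℚ._* ℚ.∣ x ∣) (δ-inverse N)) (ℚ.*-identityˡ _))))
    (ℚ.*-identityʳ (δ N))
    (ℚ.*-monoˡ-≤-nonNeg (δ N) h)

  opaque
    collision : ∃[ j ] ∃[ k ] (j < M × ℚ.∣ ι (+ suc j) ℚ.* q ℚ.- ι k ∣ ℚ.≤ δ N)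
    collision with Fin.pigeonhole (ℕ.n<1+n M) box
    -- `i < j` unfolds to `suc (toℕ i) ≤ toℕ j`, so `suc d` is the difference of the two indices: a
    -- positive multiplier, at most `M`.
    ... | i , j , i<j , eq with ℕ.m≤n⇒∃[o]m+o≡n i<j
    ... | d , i+d≡j = d , k , d<M , unscale _ close
      where
      A B : ℤ.ℤ
      A = f i ℤ./ℕ M
      B = f j ℤ./ℕ M
      k : ℤ.ℤ
      k = B ℤ.- A
      a b R D I : ℚ
      a = ι A
      b = ι B
      R = ι (+ (f i ℤ.%ℕ M))
      D = ι (+ suc d)
      I = ι (+ Fin.toℕ i)
      i+suc-d : Fin.toℕ i ℕ.+ suc d ≡ Fin.toℕ j
      i+suc-d = trans (ℕ.+-suc (Fin.toℕ i) d) i+d≡j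
      d<M : d < M
      d<M = ℕ.≤-trans (ℕ.m≤n+m (suc d) (Fin.toℕ i))
        (subst (_≤ M) (sym i+suc-d) (ℕ.≤-pred (Fin.toℕ<n j)))
      J≡ : ι (+ Fin.toℕ j) ≡ I ℚ.+ D
      J≡ = trans (cong (ι ∘ +_) (sym i+suc-d)) (ι-+ (+ Fin.toℕ i) (+ suc d))
      fj≡ : ι (f j) ≡ R ℚ.+ b ℚ.* m
      fj≡ = trans (ι-f j) (cong (λ r → ι (+ r) ℚ.+ b ℚ.* m) (sym (same-residue i j eq)))
      pj≡ : point j ≡ m ℚ.* ((I ℚ.+ D) ℚ.* q)
      pj≡ = cong (λ z → m ℚ.* (z ℚ.* q)) J≡
      close : ℚ.∣ m ℚ.* (D ℚ.* q ℚ.- ι k) ∣ ℚ.≤ 1ℚ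
      close = subst (λ z → ℚ.∣ m ℚ.* (D ℚ.* q ℚ.- z) ∣ ℚ.≤ 1ℚ) (sym (ι-- B A))
        (box-error m I D q R a b
          (subst (ℚ._≤ point i) (ι-f i) (proj₁ (proj₂ (floor-bound (point i)))))
          (subst (λ z → point i ℚ.≤ z ℚ.+ 1ℚ) (ι-f i) (proj₂ (proj₂ (floor-bound (point i)))))
          (subst₂ ℚ._≤_ fj≡ pj≡ (proj₁ (proj₂ (floor-bound (point j)))))
          (subst₂ ℚ._≤_ pj≡ (cong (ℚ._+ 1ℚ) fj≡) (proj₂ (proj₂ (floor-bound (point j))))))

opaque
  dirichlet₁ : ∀ ε → 0ℚ ℚ.< ε →
    ∃[ M ] (∀ q → ∃[ j ] ∃[ k ] (j < M × ℚ.∣ ι (+ suc j) ℚ.* q ℚ.- ι k ∣ ℚ.< ε))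
  dirichlet₁ ε 0<ε with δ-small ε 0<ε
  ... | N , small = suc N , λ q → let j , k , j<M , h = Pigeonhole.collision N q in
    j , k , j<M , ℚ.≤-<-trans h (small N ℕ.≤-refl)

-- `∣*∣-bound` asks for a number strictly above the factor `j`, hence `suc M`.
scaled-error : ∀ j M {η} x → j ≤ M → ℚ.∣ x ∣ ℚ.< η → ℚ.∣ ι (+ j) ℚ.* x ∣ ℚ.< ι (+ suc M) ℚ.* η
scaled-error j M x j≤M h =
  ∣*∣-bound (ℚ.positive⁻¹ _) (ι (+ j)) x (ι-mono-< (ℤ.+<+ (ℕ.s≤s j≤M))) h

-- The bound M does not depend on q; this is what makes the statement pass
-- from rational to real vectors.
opaque
  dirichlet : ∀ n ε → 0ℚ ℚ.< ε → ∃[ M ] (∀ (q : Fin n → ℚ) →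
    ∃[ N ] Σ (Fin n → ℤ.ℤ) λ w → N < M × (∀ i → ℚ.∣ ι (+ suc N) ℚ.* q i ℚ.- ι (w i) ∣ ℚ.< ε))
  dirichlet 0 ε 0<ε = 1 , λ _ → 0 , (λ ()) , ℕ.z<s , λ ()
  dirichlet (suc n) ε 0<ε with dirichlet₁ ε 0<ε
  -- The first coordinate will cost a further factor of at most `M₁`, so the others are approximated
  -- to within `η`, small enough to survive it.
  ... | M₁ , d₁ with scale-down M₁ ε 0<ε
  ... | η , 0<η , Mη≤ε with dirichlet n η 0<η
  ... | M₂ , d₂ = M₁ * M₂ , combine
    where
    combine : ∀ (q : Fin (suc n) → ℚ) → ∃[ N ] Σ (Fin (suc n) → ℤ.ℤ) λ w →
      N < M₁ * M₂ × (∀ i → ℚ.∣ ι (+ suc N) ℚ.* q i ℚ.- ι (w i) ∣ ℚ.< ε)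
    combine q with d₂ (q ∘ Fin.suc)
    ... | N , w , N<M₂ , h with d₁ (ι (+ suc N) ℚ.* q Fin.zero)
    -- The successor of the witness computes to `suc j * suc N`, so `ℕ.*-mono-≤` proves the strict
    -- bound.
    ... | j , k , j<M₁ , g = N ℕ.+ j * suc N , w′ , ℕ.*-mono-≤ j<M₁ N<M₂ , close
      where
      w′ : Fin (suc n) → ℤ.ℤ
      w′ Fin.zero    = k
      w′ (Fin.suc i) = + suc j ℤ.* w i
      split : ι (+ (suc j * suc N)) ≡ ι (+ suc j) ℚ.* ι (+ suc N)
      split = trans (cong ι (ℤ.pos-* (suc j) (suc N))) (ι-* (+ suc j) (+ suc N))
      close : ∀ i → ℚ.∣ ι (+ (suc j * suc N)) ℚ.* q i ℚ.- ι (w′ i) ∣ ℚ.< ε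
      close Fin.zero = subst (λ z → ℚ.∣ z ℚ.- ι k ∣ ℚ.< ε)
        (trans (sym (ℚ.*-assoc (ι (+ suc j)) (ι (+ suc N)) (q Fin.zero))) (cong (ℚ._* q Fin.zero) (sym split))) g
      close (Fin.suc i) = subst (λ z → ℚ.∣ z ∣ ℚ.< ε)
        (trans (solve 4 (λ J L Q W → J :* (L :* Q :- W) := (J :* L) :* Q :- J :* W) refl
            (ι (+ suc j)) (ι (+ suc N)) (q (Fin.suc i)) (ι (w i)))
          (cong₂ (λ a b → a ℚ.* q (Fin.suc i) ℚ.- b) (sym split) (sym (ι-* (+ suc j) (w i)))))
        (ℚ.<-≤-trans (scaled-error (suc j) M₁ _ j<M₁ (h i)) Mη≤ε)

-- Simultaneous approximation of real vectors.

opaque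
  eventually-∀ : ∀ {n} {P : Fin n → ℕ → Set} →
    (∀ i → Eventually (P i)) → Eventually (λ k → ∀ i → P i k)
  eventually-∀ {0}     h = 0 , λ _ _ ()
  eventually-∀ {suc n} h = weaken
    (λ { _ (a , b) Fin.zero → a ; _ (a , b) (Fin.suc i) → b i })
    (h Fin.zero and eventually-∀ (h ∘ Fin.suc))

approximate-multiple : ∀ L x q W {a b} →
  ℚ.∣ L ℚ.* (x ℚ.- q) ∣ ℚ.< a → ℚ.∣ L ℚ.* q ℚ.- W ∣ ℚ.< b → ℚ.∣ L ℚ.* x ℚ.- W ∣ ℚ.< a ℚ.+ b
approximate-multiple L x q W g h = subst (λ z → ℚ.∣ z ∣ ℚ.< _)
  (solve 4 (λ L x q W → L :* (x :- q) :+ (L :* q :- W) := L :* x :- W) refl L x q W)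
  (ℚ.≤-<-trans (ℚ.∣p+q∣≤∣p∣+∣q∣ (L ℚ.* (x ℚ.- q)) (L ℚ.* q ℚ.- W)) (ℚ.+-mono-< g h))

opaque
  uniformly-cauchy : ∀ {n} (v : Fin n → ℝ) κ → 0ℚ ℚ.< κ →
    ∃[ K ] (∀ i k → K ≤ k → ℚ.∣ seq (v i) k ℚ.- seq (v i) K ∣ ℚ.< κ)
  uniformly-cauchy v κ 0<κ =
    -- Being a good starting index `K` is itself a property that holds eventually, so a single `K`
    -- serves all coordinates.
    let K , c = eventually-∀ {P = λ i K → ∀ k → K ≤ k → ℚ.∣ seq (v i) k ℚ.- seq (v i) K ∣ ℚ.< κ}
          (λ i → let K , c = cauchy (v i) κ 0<κ in
            K , λ L K≤L k L≤k → c k L (ℕ.≤-trans K≤L L≤k) K≤L)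
    in K , c K ℕ.≤-refl

opaque
  dirichlet-ℝ : ∀ {n} (v : Fin n → ℝ) ε → 0ℚ ℚ.< ε → ∃[ N ] Σ (Fin n → ℤ.ℤ) λ w →
    ∀ i → Eventually (λ k → ℚ.∣ ι (+ suc N) ℚ.* seq (v i) k ℚ.- ι (w i) ∣ ℚ.< ε)
  dirichlet-ℝ {n} v ε 0<ε =
    let η , 0<η , η+η≡ε   = half ε 0<ε
        M , d             = dirichlet n η 0<η
        -- `M` is known before any sample of `v` is taken, so `κ` may depend on it; freezing `v` at
        -- index `K` then costs less than `η` even after multiplication by `suc N`.
        κ , 0<κ , Mκ≤η    = scale-down M η 0<η
        K , c             = uniformly-cauchy v κ 0<κ
        N , w , N<M , h   = d (λ i → seq (v i) K)
    in N , w , λ i → K , λ k K≤k → subst (λ z → ℚ.∣ ι (+ suc N) ℚ.* seq (v i) k ℚ.- ι (w i) ∣ ℚ.< z) η+η≡ε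
      (approximate-multiple (ι (+ suc N)) (seq (v i) k) (seq (v i) K) (ι (w i))
        (ℚ.<-≤-trans (scaled-error (suc N) M (seq (v i) k ℚ.- seq (v i) K) N<M (c i k K≤k)) Mκ≤η)
        (h i))

opaque
  positive-lower-bound : ∀ {n} (v : Fin n → ℝ) → (∀ i → 0ℝ <ℝ v i) →
    ∃[ c ] (0ℚ ℚ.< c × (∀ i → Eventually (λ k → c ℚ.≤ seq (v i) k)))
  positive-lower-bound {0}     v v>0 = 1ℚ , 0<1 , λ ()
  positive-lower-bound {suc n} v v>0 with v>0 Fin.zero | positive-lower-bound (v ∘ Fin.suc) (v>0 ∘ Fin.suc)
  ... | a , 0<a , h | b , 0<b , g = a ℚ.⊓ b , positive-min 0<a 0<b , bound
    where
    bound : ∀ i → Eventually (λ k → a ℚ.⊓ b ℚ.≤ seq (v i) k)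
    bound Fin.zero    = weaken (λ k lt → ℚ.≤-trans (ℚ.p⊓q≤p a b)
      (ℚ.<⇒≤ (subst (ℚ._< seq (v Fin.zero) k) (ℚ.+-identityˡ a) lt))) h
    bound (Fin.suc i) = weaken (λ k → ℚ.≤-trans (ℚ.p⊓q≤q a b)) (g i)

-- Order of the reals up to a rational error.

opaque
  ≤ℝ-slack-trans : ∀ x y z {a b c} → x ≤ℝ y +ℝ fromℚ a → y ≤ℝ z +ℝ fromℚ b → a ℚ.+ b ℚ.≤ c →
    x ≤ℝ z +ℝ fromℚ c
  ≤ℝ-slack-trans x y z {a} {b} {c} x≤y y≤z a+b≤c ε 0<ε with half ε 0<ε
  ... | η , 0<η , refl = weaken
    (λ k (p , q) → by-< (ℚ.+-mono-<-≤ (ℚ.+-mono-< p q) a+b≤c)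
      (solve 7 (λ x y z a b c e →
          ((y :+ a :+ e) :+ (z :+ b :+ e) :+ c) :- ((x :+ y) :+ (a :+ b)) := (z :+ c :+ (e :+ e)) :- x)
        refl (seq x k) (seq y k) (seq z k) a b c η))
    (x≤y η 0<η and y≤z η 0<η)

opaque
  ≤ℝ⇒≤ℝ-slack : ∀ x y {a} → 0ℚ ℚ.≤ a → x ≤ℝ y → x ≤ℝ y +ℝ fromℚ a
  ≤ℝ⇒≤ℝ-slack x y {a} 0≤a x≤y ε 0<ε = weaken
    (λ k p → ℚ.<-≤-trans p (by-≤ 0≤a
      (solve 3 (λ y a e → a :- con 0ℚ := (y :+ a :+ e) :- (y :+ e)) refl (seq y k) a ε)))
    (x≤y ε 0<ε)

opaque
  ≤ℝ-slack-mono : ∀ x y {a b} → a ℚ.≤ b → x ≤ℝ y +ℝ fromℚ a → x ≤ℝ y +ℝ fromℚ b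
  ≤ℝ-slack-mono x y {a} {b} a≤b x≤y = ≤ℝ-slack-trans x y y x≤y
    (≤ℝ⇒≤ℝ-slack y y ℚ.≤-refl (≤ℝ-refl {y}))
    (subst (ℚ._≤ b) (sym (ℚ.+-identityʳ a)) a≤b)

opaque
  ≈ℝ-sym : ∀ x y → x ≈ℝ y → y ≈ℝ x
  ≈ℝ-sym x y x≈y ε 0<ε = weaken (λ k → subst (ℚ._< ε) (∣-∣-sym (seq x k) (seq y k))) (x≈y ε 0<ε)

opaque
  ≈ℝ-refl : ∀ x → x ≈ℝ x
  ≈ℝ-refl x ε 0<ε = always λ k →
    subst (λ z → ℚ.∣ z ∣ ℚ.< ε) (sym (ℚ.+-inverseʳ (seq x k))) 0<ε

opaque
  slack⇒≈ℝ : ∀ x y →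
    (∀ ε → 0ℚ ℚ.< ε → x ≤ℝ y +ℝ fromℚ ε × y ≤ℝ x +ℝ fromℚ ε) → x ≈ℝ y
  slack⇒≈ℝ x y h ε 0<ε with half ε 0<ε
  ... | η , 0<η , refl = weaken
    (λ k (p , q) → <⇒∣p-q∣<e {seq x k} {seq y k}
      (subst (seq x k ℚ.<_) (ℚ.+-assoc (seq y k) η η) p)
      (subst (seq y k ℚ.<_) (ℚ.+-assoc (seq x k) η η) q))
    (proj₁ (h η 0<η) η 0<η and proj₂ (h η 0<η) η 0<η)

opaque
  em⇒dne : ExcludedMiddle 0ℓ → {P : Set} → ¬ ¬ P → P
  em⇒dne em {P} ¬¬p with em {P}
  ... | yes p = p
  ... | no ¬p = ⊥-elim (¬¬p ¬p)

opaque
  -- By totality the failure gives `y + e ≤ x`; with the error moved to the right, `x - e` can serve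
  -- as an upper bound.
  ≰ℝ⇒decrease : ExcludedMiddle 0ℓ → ∀ x y e → ¬ (x ≤ℝ y +ℝ fromℚ e) → y ≤ℝ x +ℝ fromℚ (ℚ.- e)
  ≰ℝ⇒decrease em x y e x≰ ε 0<ε with ≤ℝ-total em x (y +ℝ fromℚ e)
  ... | inj₁ x≤ = ⊥-elim (x≰ x≤)
  ... | inj₂ ≤x = weaken (λ k lt → by-< lt
    (solve 4 (λ x y e d → (x :+ d) :- (y :+ e) := (x :+ (:- e) :+ d) :- y) refl
      (seq x k) (seq y k) e ε)) (≤x ε 0<ε)

opaque
  ≰ℝ-decrease : ∀ x e → 0ℚ ℚ.< e → ¬ (x ≤ℝ x +ℝ fromℚ (ℚ.- e))
  ≰ℝ-decrease x e 0<e x≤ with x≤ e 0<e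
  ... | K , h = ℚ.<-irrefl refl (by-< {c = 0ℚ} {d = 0ℚ} (h K ℕ.≤-refl)
    (solve 2 (λ x e → (x :+ (:- e) :+ e) :- x := con 0ℚ :- con 0ℚ) refl (seq x K) e))

-- Stability of loneliness under small perturbations.

opaque
  ∣-∣-shift : ∀ a b m k {e} → ℚ.∣ a ℚ.- (m ℚ.+ b) ∣ ℚ.≤ e →
    ℚ.∣ a ℚ.- (m ℚ.+ k) ∣ ℚ.≤ ℚ.∣ b ℚ.- k ∣ ℚ.+ e
  ∣-∣-shift a b m k {e} h = subst (λ z → ℚ.∣ z ∣ ℚ.≤ ℚ.∣ b ℚ.- k ∣ ℚ.+ e)
    (solve 4 (λ a b m k → (b :- k) :+ (a :- (m :+ b)) := a :- (m :+ k)) refl a b m k)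
    (ℚ.≤-trans (ℚ.∣p+q∣≤∣p∣+∣q∣ (b ℚ.- k) (a ℚ.- (m ℚ.+ b))) (ℚ.+-monoʳ-≤ ℚ.∣ b ℚ.- k ∣ h))

opaque
  -- If `j` is nearest to `y`, then `m + j` lies within `∥ y ∥ + e` of `x`, and the nearest integer
  -- to `x` does at least as well.
  ∥∥-lipschitz : ∀ (em : ExcludedMiddle 0ℓ) x y m {e} →
    Eventually (λ k → ℚ.∣ seq x k ℚ.- (ι m ℚ.+ seq y k) ∣ ℚ.≤ e) →
    ∥ x ∥[ em ] ≤ℝ ∥ y ∥[ em ] +ℝ fromℚ e
  ∥∥-lipschitz em x y m {e} h =
    ≤ℝ-trans {∥ x ∥[ em ]} {∣ x -ℝ fromℤ (m ℤ.+ j) ∣ℝ} {∥ y ∥[ em ] +ℝ fromℚ e}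
      (proj₂ (nearest em x) (m ℤ.+ j))
      (pointwise-≤ {∣ x -ℝ fromℤ (m ℤ.+ j) ∣ℝ} {∥ y ∥[ em ] +ℝ fromℚ e} (weaken
        (λ k le → subst₂ (λ p q → ℚ.∣ seq x k ℚ.- p ∣ ℚ.≤ ℚ.∣ seq y k ℚ.- q ∣ ℚ.+ e)
          (trans (sym (ι-+ m j)) (sym (/1≡ι (m ℤ.+ j)))) (sym (/1≡ι j))
          (∣-∣-shift (seq x k) (seq y k) (ι m) (ι j) le))
        h))
    where
    j : ℤ.ℤ
    j = proj₁ (nearest em y)

opaque
  minimum-lipschitz : ∀ {n} .{{_ : NonZero n}} (f g : Fin n → ℝ) {e} →
    (∀ i → f i ≤ℝ g i +ℝ fromℚ e) → minimum f ≤ℝ minimum g +ℝ fromℚ e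
  minimum-lipschitz {suc 0}       f g h = h Fin.zero
  minimum-lipschitz {suc (suc n)} f g {e} h ε 0<ε = weaken step
    (h Fin.zero ε 0<ε and minimum-lipschitz (f ∘ Fin.suc) (g ∘ Fin.suc) (h ∘ Fin.suc) ε 0<ε)
    where
    f₀ g₀ f₊ g₊ : ℕ → ℚ
    f₀ = seq (f Fin.zero)
    g₀ = seq (g Fin.zero)
    f₊ = seq (minimum (f ∘ Fin.suc))
    g₊ = seq (minimum (g ∘ Fin.suc))
    step : ∀ k → f₀ k ℚ.< g₀ k ℚ.+ e ℚ.+ ε × f₊ k ℚ.< g₊ k ℚ.+ e ℚ.+ ε →
      f₀ k ℚ.⊓ f₊ k ℚ.< (g₀ k ℚ.⊓ g₊ k) ℚ.+ e ℚ.+ ε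
    step k (a , b) with ℚ.⊓-sel (g₀ k) (g₊ k)
    ... | inj₁ eq = subst (λ z → f₀ k ℚ.⊓ f₊ k ℚ.< z ℚ.+ e ℚ.+ ε) (sym eq)
      (ℚ.≤-<-trans (ℚ.p⊓q≤p (f₀ k) (f₊ k)) a)
    ... | inj₂ eq = subst (λ z → f₀ k ℚ.⊓ f₊ k ℚ.< z ℚ.+ e ℚ.+ ε) (sym eq)
      (ℚ.≤-<-trans (ℚ.p⊓q≤q (f₀ k) (f₊ k)) b)

-- The supremum over all times.

module _ (em : ExcludedMiddle 0ℓ) {n : ℕ} .{{_ : NonZero n}} where

  opaque
    loneliness≤ML : ∀ (v : Fin n → ℝ) t → loneliness em v t ≤ℝ ML em v
    loneliness≤ML v t = proj₁ (proj₂ (ML-supremum em v)) (loneliness em v t)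
      (t , ≈ℝ-refl (loneliness em v t))

  opaque
    ML-least : ∀ (v : Fin n → ℝ) b → (∀ t → loneliness em v t ≤ℝ b) → ML em v ≤ℝ b
    ML-least v b h = proj₂ (proj₂ (ML-supremum em v)) b λ y (t , y≈) →
      ≤ℝ-trans {y} {loneliness em v t} {b} (≈ℝ⇒≤ℝ {y} {loneliness em v t} y≈) (h t)

  opaque
    -- Otherwise every value would be at most `ML - e`, an upper bound below the least one.
    ML-approached : ∀ (v : Fin n → ℝ) e → 0ℚ ℚ.< e →
      ∃[ t ] (ML em v ≤ℝ loneliness em v t +ℝ fromℚ e)
    ML-approached v e 0<e = em⇒dne em λ ¬p → ≰ℝ-decrease (ML em v) e 0<e
      (ML-least v (ML em v +ℝ fromℚ (ℚ.- e)) λ t →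
        ≰ℝ⇒decrease em (ML em v) (loneliness em v t) e λ le → ¬p (t , le))

  opaque
    -- Both comparisons below trade a time for one speed vector for a time for the other; the
    -- integer shift `m` may vary with the coordinate.
    loneliness-lipschitz : ∀ (v u : Fin n → ℝ) t t′ {e} →
      (∀ i → ∃[ m ] Eventually (λ k →
        ℚ.∣ seq (t *ℝ v i) k ℚ.- (ι m ℚ.+ seq (t′ *ℝ u i) k) ∣ ℚ.≤ e)) →
      loneliness em v t ≤ℝ ML em u +ℝ fromℚ e
    loneliness-lipschitz v u t t′ {e} h = ≤ℝ-slack-trans
      (loneliness em v t) (loneliness em u t′) (ML em u)
      (minimum-lipschitz (λ i → ∥ t *ℝ v i ∥[ em ]) (λ i → ∥ t′ *ℝ u i ∥[ em ])
        (λ i → ∥∥-lipschitz em (t *ℝ v i) (t′ *ℝ u i) (proj₁ (h i)) (proj₂ (h i))))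
      (≤ℝ⇒≤ℝ-slack (loneliness em u t′) (ML em u) ℚ.≤-refl (loneliness≤ML u t′))
      (ℚ.≤-reflexive (ℚ.+-identityʳ e))

-- Comparison of real speeds with their integer approximants.

3ℚ : ℚ
3ℚ = ι (+ 3)

opaque
  -- The integer is the floor of one late term, within 2 of every later term; 3 makes the bound
  -- strict.
  nearby-integer : ∀ t → ∃[ j ] Eventually (λ k → ℚ.∣ seq t k ℚ.- j ℚ./ 1 ∣ ℚ.< 3ℚ)
  nearby-integer t with cauchy t 1ℚ 0<1
  ... | N , p with floor-bound (seq t N)
  ... | j , lo , hi = j , N , λ k N≤k → subst (λ z → ℚ.∣ seq t k ℚ.- z ∣ ℚ.< 3ℚ) (sym (/1≡ι j))
    (ℚ.≤-<-trans (within-2 (seq t k) (seq t N) (ι j) (p k N N≤k ℕ.≤-refl) lo hi)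
      (ℚ.*<* (ℤ.+<+ (ℕ.s≤s (ℕ.s≤s (ℕ.s≤s ℕ.z≤n))))))

opaque
  -- For integers `j` and `w`, lowering the time by `j` changes `t w` by the integer `j w`; what
  -- remains is `(t - j) (L v - w)` up to sign.
  reduced-time-error : ∀ t j L v w {b ε} → 0ℚ ℚ.< b →
    ℚ.∣ t ℚ.- j ∣ ℚ.< b → ℚ.∣ L ℚ.* v ℚ.- w ∣ ℚ.< ε →
    ℚ.∣ t ℚ.* w ℚ.- (j ℚ.* w ℚ.+ ((t ℚ.- j) ℚ.* L) ℚ.* v) ∣ ℚ.≤ b ℚ.* ε
  reduced-time-error t j L v w {b} {ε} 0<b g h = ℚ.<⇒≤ (subst (ℚ._< b ℚ.* ε)
    (trans (sym (ℚ.∣-p∣≡∣p∣ ((t ℚ.- j) ℚ.* (L ℚ.* v ℚ.- w)))) (cong ℚ.∣_∣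
      (solve 5 (λ t j L v w →
          :- ((t :- j) :* (L :* v :- w)) := t :* w :- (j :* w :+ ((t :- j) :* L) :* v))
        refl t j L v w)))
    (∣*∣-bound 0<b (t ℚ.- j) (L ℚ.* v ℚ.- w) g h))

opaque
  -- Time `t / (N + 1)` for `w` imitates time `t` for `v`. Bounding `δ N` by 1 keeps the estimate
  -- independent of `N`; the summand `0ℚ` is the integer shift.
  divided-time-error : ∀ t N v w {b ε} → 0ℚ ℚ.< b →
    ℚ.∣ t ∣ ℚ.< b → ℚ.∣ ι (+ suc N) ℚ.* v ℚ.- w ∣ ℚ.< ε →
    ℚ.∣ t ℚ.* v ℚ.- (0ℚ ℚ.+ (t ℚ.* δ N) ℚ.* w) ∣ ℚ.≤ b ℚ.* ε
  divided-time-error t N v w {b} {ε} 0<b g h = ℚ.<⇒≤ (subst (λ z → ℚ.∣ z ∣ ℚ.< b ℚ.* ε)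
    (trans (solve 5 (λ t d L v w →
          (t :* d) :* (L :* v :- w) := t :* ((d :* L) :* v) :- (con 0ℚ :+ (t :* d) :* w))
        refl t (δ N) (ι (+ suc N)) v w)
      (cong (λ z → t ℚ.* z ℚ.- (0ℚ ℚ.+ (t ℚ.* δ N) ℚ.* w))
        (trans (cong (ℚ._* v) (δ-inverse N)) (ℚ.*-identityˡ v))))
    (∣*∣-bound 0<b (t ℚ.* δ N) (ι (+ suc N) ℚ.* v ℚ.- w) small h))
    where
    δ≤1 : δ N ℚ.≤ 1ℚ
    δ≤1 = ℚ.*≤* (ℤ.+≤+ (ℕ.s≤s ℕ.z≤n))
    small : ℚ.∣ t ℚ.* δ N ∣ ℚ.< b
    small = ℚ.≤-<-trans
      (subst₂ ℚ._≤_ (sym (ℚ.∣p*q∣≡∣p∣*∣q∣ t (δ N))) (ℚ.*-identityʳ ℚ.∣ t ∣)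
        (ℚ.*-monoˡ-≤-nonNeg ℚ.∣ t ∣ {{ℚ.∣-∣-nonNeg t}} δ≤1)) g

module _ (em : ExcludedMiddle 0ℓ) {n : ℕ} .{{_ : NonZero n}} (v : Fin n → ℝ)
         (N : ℕ) (w : Fin n → ℕ) {ε : ℚ}
         (approx : ∀ i → Eventually (λ k →
           ℚ.∣ ι (+ suc N) ℚ.* seq (v i) k ℚ.- ι (+ w i) ∣ ℚ.< ε)) where

  -- Integer speeds make t w periodic in t, so only times within a bounded
  -- distance of 0 matter, and there t w stays close to (N + 1) t v.
  opaque
    ML-integer≤ : ML em (λ i → fromℕ (w i)) ≤ℝ ML em v +ℝ fromℚ (3ℚ ℚ.* ε)
    ML-integer≤ = ML-least em _ (ML em v +ℝ fromℚ (3ℚ ℚ.* ε)) bound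
      where
      bound : ∀ t → loneliness em (λ i → fromℕ (w i)) t ≤ℝ ML em v +ℝ fromℚ (3ℚ ℚ.* ε)
      bound t with nearby-integer t
      ... | j , t-j<3 = loneliness-lipschitz em (λ i → fromℕ (w i)) v t
        ((t -ℝ fromℤ j) *ℝ fromℚ (ι (+ suc N)))
        λ i → j ℤ.* + w i , weaken
          (λ k (g , h) → subst₂ (λ a b → ℚ.∣ seq t k ℚ.* a ℚ.- (b ℚ.+
              ((seq t k ℚ.- j / 1) ℚ.* ι (+ suc N)) ℚ.* seq (v i) k) ∣ ℚ.≤ 3ℚ ℚ.* ε)
            (sym (/1≡ι (+ w i)))
            (trans (cong (ℚ._* ι (+ w i)) (/1≡ι j)) (sym (ι-* j (+ w i))))
            (reduced-time-error (seq t k) (j / 1) (ι (+ suc N)) (seq (v i) k) (ι (+ w i))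
              (ℚ.positive⁻¹ 3ℚ) g h))
          (t-j<3 and approx i)

  opaque
    -- Real speeds have no common period in general, so the loss grows with the bound `b` on the
    -- time; in use, `t` is fixed before `N` and `w`.
    loneliness≤ML-integer : ∀ t {b} → 0ℚ ℚ.< b → Eventually (λ k → ℚ.∣ seq t k ∣ ℚ.< b) →
      loneliness em v t ≤ℝ ML em (λ i → fromℕ (w i)) +ℝ fromℚ (b ℚ.* ε)
    loneliness≤ML-integer t {b} 0<b t<b = loneliness-lipschitz em v (λ i → fromℕ (w i)) t
      (t *ℝ fromℚ (δ N))
      λ i → + 0 , weaken
        (λ k (g , h) → subst (λ a → ℚ.∣ seq t k ℚ.* seq (v i) k ℚ.-
            (0ℚ ℚ.+ (seq t k ℚ.* δ N) ℚ.* a) ∣ ℚ.≤ b ℚ.* ε)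
          (sym (/1≡ι (+ w i)))
          (divided-time-error (seq t k) N (seq (v i) k) (ι (+ w i)) 0<b g h))
        (t<b and approx i)

-- Approximation of the maximum loneliness by positive integer speeds.

opaque
  -- As the multiplier is at least 1, `(N + 1) v` is at least `c`, and an error below `c` cannot
  -- bring it down to 0.
  approximant-positive : ∀ N v w {c} → 0ℚ ℚ.< c → c ℚ.≤ v →
    ℚ.∣ ι (+ suc N) ℚ.* v ℚ.- w ∣ ℚ.< c → 0ℚ ℚ.< w
  approximant-positive N v w {c} 0<c c≤v h = by-<
    (ℚ.+-mono-≤-< (ℚ.≤-trans c≤v v≤Lv)
      (ℚ.≤-<-trans (p≤∣p∣ (ι (+ suc N) ℚ.* v ℚ.- w)) h))
    (solve 3 (λ x w c → (x :+ c) :- (c :+ (x :- w)) := w :- con 0ℚ) refl (ι (+ suc N) ℚ.* v) w c)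
    where
    v≤Lv : v ℚ.≤ ι (+ suc N) ℚ.* v
    v≤Lv = subst (ℚ._≤ ι (+ suc N) ℚ.* v) (ℚ.*-identityˡ v)
      (ℚ.*-monoʳ-≤-nonNeg v {{ℚ.nonNegative (ℚ.≤-trans (ℚ.<⇒≤ 0<c) c≤v)}}
        (ι-mono (ℤ.+≤+ (ℕ.s≤s ℕ.z≤n))))

opaque
  positive-dirichlet-ℝ : ∀ {n} (v : Fin n → ℝ) → (∀ i → 0ℝ <ℝ v i) → ∀ ε → 0ℚ ℚ.< ε →
    ∃[ N ] Σ (Fin n → ℕ) λ w → (∀ i → 0 < w i) ×
      (∀ i → Eventually (λ k → ℚ.∣ ι (+ suc N) ℚ.* seq (v i) k ℚ.- ι (+ w i) ∣ ℚ.< ε))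
  positive-dirichlet-ℝ v v>0 ε 0<ε with positive-lower-bound v v>0
  -- Accuracy better than `c` makes every integer positive.
  ... | c , 0<c , c≤v with dirichlet-ℝ v (ε ℚ.⊓ c) (positive-min 0<ε 0<c)
  ... | N , w , h = N , (λ i → proj₁ (nat i)) , (λ i → proj₁ (proj₂ (nat i)))
    , λ i → weaken (λ k lt → ℚ.<-≤-trans
        (subst (λ z → ℚ.∣ ι (+ suc N) ℚ.* seq (v i) k ℚ.- ι z ∣ ℚ.< ε ℚ.⊓ c) (proj₂ (proj₂ (nat i))) lt)
        (ℚ.p⊓q≤p ε c)) (h i)
    where
    pos : ∀ i → 0ℚ ℚ.< ι (w i)
    pos i with c≤v i and h i
    ... | K , p = approximant-positive N (seq (v i) K) (ι (w i)) 0<c (proj₁ (p K ℕ.≤-refl))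
      (ℚ.<-≤-trans (proj₂ (p K ℕ.≤-refl)) (ℚ.p⊓q≤q ε c))
    nat : ∀ i → ∃[ m ] (0 < m × w i ≡ + m)
    nat i = ι-pos⁻¹ (w i) (pos i)

opaque
  p≤p+q : ∀ p {q} → 0ℚ ℚ.≤ q → p ℚ.≤ p ℚ.+ q
  p≤p+q p {q} 0≤q = by-≤ 0≤q (solve 2 (λ p q → q :- con 0ℚ := (p :+ q) :- p) refl p q)

opaque
  0≤* : ∀ {p q} → 0ℚ ℚ.< p → 0ℚ ℚ.< q → 0ℚ ℚ.≤ p ℚ.* q
  0≤* {p} {q} 0<p 0<q = subst (ℚ._≤ p ℚ.* q) (ℚ.*-zeroʳ p)
    (ℚ.*-monoˡ-≤-nonNeg p {{ℚ.nonNegative (ℚ.<⇒≤ 0<p)}} (ℚ.<⇒≤ 0<q))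

opaque
  ML-integer-dense : (em : ExcludedMiddle 0ℓ) {n : ℕ} .{{_ : NonZero n}} (v : Fin n → ℝ) →
    (∀ i → 0ℝ <ℝ v i) → ∀ e → 0ℚ ℚ.< e → Σ (Fin n → ℕ) λ w → (∀ i → 0 < w i) ×
      ML em v ≤ℝ ML em (λ i → fromℕ (w i)) +ℝ fromℚ e ×
      ML em (λ i → fromℕ (w i)) ≤ℝ ML em v +ℝ fromℚ e
  ML-integer-dense em v v>0 e 0<e =
    let d , 0<d , d+d≡e   = half e 0<e
        -- The order matters: the nearly optimal time comes first, its bound `B` determines `η`, and
        -- only then are the integers chosen. Half of `e` pays for near-optimality, the other half
        -- covers `B η`; `3 η` also stays within `d`.
        t , near-t        = ML-approached em v d 0<d
        B , 0<B , t<B     = bounded t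
        η , 0<η , 3η+Bη≡d = divide 3ℚ B d (ℚ.positive⁻¹ 3ℚ) 0<B 0<d
        N , w , w>0 , h   = positive-dirichlet-ℝ v v>0 η 0<η
        3η≤d : 3ℚ ℚ.* η ℚ.≤ d
        3η≤d = subst (3ℚ ℚ.* η ℚ.≤_) 3η+Bη≡d (p≤p+q (3ℚ ℚ.* η) (0≤* 0<B 0<η))
        Bη≤d : B ℚ.* η ℚ.≤ d
        Bη≤d = subst (B ℚ.* η ℚ.≤_) (trans (ℚ.+-comm (B ℚ.* η) (3ℚ ℚ.* η)) 3η+Bη≡d)
          (p≤p+q (B ℚ.* η) (0≤* (ℚ.positive⁻¹ 3ℚ) 0<η))
    in w , w>0
      , ≤ℝ-slack-trans (ML em v) (loneliness em v t) (ML em (λ i → fromℕ (w i))) near-t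
          (loneliness≤ML-integer em v N w h t 0<B t<B)
          (subst (d ℚ.+ B ℚ.* η ℚ.≤_) d+d≡e (ℚ.+-monoʳ-≤ d Bη≤d))
      , ≤ℝ-slack-mono (ML em (λ i → fromℕ (w i))) (ML em v)
          (ℚ.≤-trans 3η≤d (subst (d ℚ.≤_) d+d≡e (p≤p+q d (ℚ.<⇒≤ 0<d))))
          (ML-integer≤ em v N w h)

-- Closedness of the spectrum.

opaque
  -- Pigeonhole over finitely many indices: if the last one fails at some `e₀`, by monotonicity it
  -- fails at every smaller tolerance, so tolerances cut down to `e₀` leave a smaller index.
  finite-limit : ExcludedMiddle 0ℓ → (P : ℕ → ℚ → Set) → (∀ s {d e} → d ℚ.≤ e → P s d → P s e) →
    ∀ S → (∀ e → 0ℚ ℚ.< e → ∃[ s ] (s < S × P s e)) → ∃[ s ] (∀ e → 0ℚ ℚ.< e → P s e)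
  finite-limit em P mono 0 h with h 1ℚ 0<1
  ... | _ , () , _
  finite-limit em P mono (suc S) h with em {∃[ e ] (0ℚ ℚ.< e × ¬ P S e)}
  ... | no  ¬e = S , λ e 0<e → em⇒dne em λ ¬p → ¬e (e , 0<e , ¬p)
  ... | yes (e₀ , 0<e₀ , ¬P) = finite-limit em P mono S below
    where
    below : ∀ e → 0ℚ ℚ.< e → ∃[ s ] (s < S × P s e)
    below e 0<e with h (e ℚ.⊓ e₀) (positive-min 0<e 0<e₀)
    ... | s , s<1+S , p with ℕ.m≤n⇒m<n∨m≡n (ℕ.≤-pred s<1+S)
    ... | inj₁ s<S  = s , s<S , mono s (ℚ.p⊓q≤p e e₀) p
    ... | inj₂ refl = ⊥-elim (¬P (mono s (ℚ.p⊓q≤q e e₀) p))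

opaque
  -- The gap `1/n - s/(ns+1)` equals `1/(n(ns+1))`, and `n(ns+1)` is at least `s+1`.
  1/n≤s/[ns+1]+δ : ∀ n .{{_ : NonZero n}} s → + 1 / n ℚ.≤ + s / suc (n * s) ℚ.+ δ s
  1/n≤s/[ns+1]+δ n@(suc m) s = ℚ.toℚᵘ-cancel-≤ (begin
    ℚ.toℚᵘ (+ 1 / n)                                ≃⟨ ℚ.toℚᵘ-fromℚᵘ (ℚᵘ.mkℚᵘ (+ 1) m) ⟩
    ℚᵘ.mkℚᵘ (+ 1) m                                 ≤⟨ ℚᵘ.*≤* integral ⟩
    ℚᵘ.mkℚᵘ (+ s) (n * s) ℚᵘ.+ ℚᵘ.mkℚᵘ (+ 1) s      ≃⟨ ℚᵘ.+-congˡ (ℚᵘ.mkℚᵘ (+ 1) s)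
                                                         (ℚ.toℚᵘ-fromℚᵘ (ℚᵘ.mkℚᵘ (+ s) (n * s))) ⟨
    ℚ.toℚᵘ (+ s / suc (n * s)) ℚᵘ.+ ℚ.toℚᵘ (δ s)    ≃⟨ ℚ.toℚᵘ-homo-+ (+ s / suc (n * s)) (δ s) ⟨
    ℚ.toℚᵘ (+ s / suc (n * s) ℚ.+ δ s)              ∎)
    where
    open ℚᵘ.≤-Reasoning
    -- With `n = m + 1`, the cross-multiplied sides differ by the natural number
    -- `(n - 1) + (n² - 1) s`.
    identity : suc (n * s) * suc s ℕ.+ (m ℕ.+ (2 * m ℕ.+ m * m) * s) ≡ (s * suc s ℕ.+ suc (n * s)) * n
    identity = ℕ-Solver.solve 2 (λ m s →
        (one :+ₙ (one :+ₙ m) :*ₙ s) :*ₙ (one :+ₙ s) :+ₙ (m :+ₙ (ℕ-Solver.con 2 :*ₙ m :+ₙ m :*ₙ m) :*ₙ s)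
          :=ₙ (s :*ₙ (one :+ₙ s) :+ₙ (one :+ₙ (one :+ₙ m) :*ₙ s)) :*ₙ (one :+ₙ m)) refl m s
      where
      open ℕ-Solver using () renaming (_:+_ to _:+ₙ_; _:*_ to _:*ₙ_; _:=_ to _:=ₙ_)
      one : ∀ {k} → ℕ-Solver.Polynomial k
      one = ℕ-Solver.con 1
    integral : + 1 ℤ.* + (suc (n * s) * suc s) ℤ.≤ (+ s ℤ.* + suc s ℤ.+ + 1 ℤ.* + suc (n * s)) ℤ.* + n
    integral = subst₂ ℤ._≤_
      (sym (ℤ.*-identityˡ _))
      (trans (ℤ.pos-* (s * suc s ℕ.+ suc (n * s)) n)
        (cong (ℤ._* + n) (cong₂ ℤ._+_ (ℤ.pos-* s (suc s)) (sym (ℤ.*-identityˡ (+ suc (n * s)))))))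
      (ℤ.+≤+ (subst (suc (n * s) * suc s ≤_) identity (ℕ.m≤m+n _ _)))

-- The alternative of the theorem for a general sequence and threshold, used with `s/(ns+1)` and
-- `1/n`; this separates the limit argument from loneliness.
InSpectrum : (ℕ → ℚ) → ℚ → ℝ → Set
InSpectrum a l x = (∃[ s ] (0 < s × x ≈ℝ fromℚ (a s))) ⊎ fromℚ l ≤ℝ x

opaque
  <ℝ⇒≰ℝ-slack : ∀ x y {a b} → 0ℚ ℚ.< b → Eventually (λ k → seq x k ℚ.+ (a ℚ.+ b) ℚ.< seq y k) →
    ¬ (y ≤ℝ x +ℝ fromℚ a)
  <ℝ⇒≰ℝ-slack x y {a} {b} 0<b x<y y≤ with x<y and y≤ b 0<b
  ... | K , h = ℚ.<-asym (proj₁ (h K ℕ.≤-refl))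
    (subst (seq y K ℚ.<_) (ℚ.+-assoc (seq x K) a b) (proj₂ (h K ℕ.≤-refl)))

-- The values a s can accumulate only at or above l, so a limit smaller than l
-- is approached by finitely many of them.
opaque
  spectrum-closed : ExcludedMiddle 0ℓ → ∀ a l → (∀ s → l ℚ.≤ a s ℚ.+ δ s) → ∀ L →
    (∀ e → 0ℚ ℚ.< e → ∃[ y ] (L ≤ℝ y +ℝ fromℚ e × y ≤ℝ L +ℝ fromℚ e × InSpectrum a l y)) →
    InSpectrum a l L
  spectrum-closed em a l l≤a+δ L approached with em {L <ℝ fromℚ l}
  ... | no  L≮ = inj₂ (≮ℝ⇒≥ℝ {L} {fromℚ l} L≮)
  ... | yes (ε , 0<ε , L<) with half ε 0<ε
  -- The gap is quartered: `l` exceeds `L + 4κ`, whereas an index `s ≥ S` with `a s ≤ L + κ` would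
  -- give `l ≤ a s + κ ≤ L + 2κ`.
  ... | η , 0<η , refl with half η 0<η
  ... | κ , 0<κ , refl with δ-small κ 0<κ
  ... | S , small = inj₁ (conclude (finite-limit em Close mono S candidates))
    where
    Close : ℕ → ℚ → Set
    Close s e = 0 < s × L ≤ℝ fromℚ (a s) +ℝ fromℚ e × fromℚ (a s) ≤ℝ L +ℝ fromℚ e

    mono : ∀ s {d e} → d ℚ.≤ e → Close s d → Close s e
    mono s d≤e (0<s , p , q) = 0<s
      , ≤ℝ-slack-mono L (fromℚ (a s)) d≤e p
      , ≤ℝ-slack-mono (fromℚ (a s)) L d≤e q

    below : ¬ (fromℚ l ≤ℝ L +ℝ fromℚ (κ ℚ.+ κ))
    below = <ℝ⇒≰ℝ-slack L (fromℚ l) 0<η L<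

    bounded-index : ∀ s → fromℚ (a s) ≤ℝ L +ℝ fromℚ κ → s < S
    bounded-index s s≤ = ℕ.≰⇒> λ S≤s → below
      (≤ℝ-slack-trans (fromℚ l) (fromℚ (a s)) L {κ} {κ}
        (pointwise-≤ {fromℚ l} {fromℚ (a s) +ℝ fromℚ κ} (always λ _ →
          ℚ.≤-trans (l≤a+δ s) (ℚ.+-monoʳ-≤ (a s) (ℚ.<⇒≤ (small s S≤s)))))
        s≤ ℚ.≤-refl)

    candidates : ∀ e → 0ℚ ℚ.< e → ∃[ s ] (s < S × Close s e)
    -- The bound `κ` confines the index to `s < S` and rules out values from `l` on; `e` gives the
    -- required closeness.
    candidates e 0<e with approached (e ℚ.⊓ κ) (positive-min 0<e 0<κ)
    ... | y , L≤ , y≤ , inj₂ l≤y = ⊥-elim (below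
      (≤ℝ-slack-trans (fromℚ l) y L {0ℚ} {e ℚ.⊓ κ}
        (≤ℝ⇒≤ℝ-slack (fromℚ l) y ℚ.≤-refl l≤y) y≤
        (ℚ.+-mono-≤ (ℚ.<⇒≤ 0<κ) (ℚ.p⊓q≤q e κ))))
    ... | y , L≤ , y≤ , inj₁ (s , 0<s , y≈) =
      s , bounded-index s (≤ℝ-slack-mono x L (ℚ.p⊓q≤q e κ) x≤)
        , mono s (ℚ.p⊓q≤p e κ) (0<s , ≤x , x≤)
      where
      x : ℝ
      x = fromℚ (a s)
      x≤ : x ≤ℝ L +ℝ fromℚ (e ℚ.⊓ κ)
      x≤ = ≤ℝ-trans {x} {y} {L +ℝ fromℚ (e ℚ.⊓ κ)} (≈ℝ⇒≤ℝ {x} {y} (≈ℝ-sym y x y≈)) y≤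
      ≤x : L ≤ℝ x +ℝ fromℚ (e ℚ.⊓ κ)
      ≤x = ≤ℝ-slack-trans L y x {e ℚ.⊓ κ} {0ℚ} L≤
        (≤ℝ⇒≤ℝ-slack y x ℚ.≤-refl (≈ℝ⇒≤ℝ {y} {x} y≈)) (ℚ.≤-reflexive (ℚ.+-identityʳ _))

    conclude : ∃[ s ] (∀ e → 0ℚ ℚ.< e → Close s e) → ∃[ s ] (0 < s × L ≈ℝ fromℚ (a s))
    -- Positivity of the index does not depend on the tolerance, so it is read off at 1.
    conclude (s , close) = s , proj₁ (close 1ℚ 0<1)
      , slack⇒≈ℝ L (fromℚ (a s)) (λ e 0<e → proj₂ (close e 0<e))

theorem3p4 : (em : ExcludedMiddle 0ℓ) (n : ℕ) .{{_ : NonZero n}} → 2 ≤ n →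
    ((w : Fin n → ℕ) → (∀ i → 0 < w i) →
    (∃[ s ] (0 < s × ML em (λ i → fromℕ (w i)) ≈ℝ fromℚ (+ s / suc (n * s))))
    ⊎ fromℚ (+ 1 / n) ≤ℝ ML em (λ i → fromℕ (w i))) →
    (v : Fin n → ℝ) → (∀ i → 0ℝ <ℝ v i) →
    (∃[ s ] (0 < s × ML em v ≈ℝ fromℚ (+ s / suc (n * s))))
    ⊎ fromℚ (+ 1 / n) ≤ℝ ML em v
theorem3p4 em n _ integer-case v v>0 = spectrum-closed em
  (λ s → + s / suc (n * s)) (+ 1 / n) (1/n≤s/[ns+1]+δ n) (ML em v) λ e 0<e →
  let w , w>0 , v≤w , w≤v = ML-integer-dense em v v>0 e 0<e
  in ML em (λ i → fromℕ (w i)) , v≤w , w≤v , integer-case w w>0
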